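{- Let $\mathcal{G}$ be a hypergraph with rank $r(\mathcal{G})=r$. Then the strong chromatic number satisfies $\gamma(\mathcal{G})\le 1+(r-1)\lambda_{\max}(A_{\mathcal{G}})$, where $\lambda_{\max}(A_{\mathcal{G}})$ is the largest eigenvalue of $A_{\mathcal{G}}$.
   Context: A hypergraph $\mathcal{G}=(V,E)$ has a finite vertex set $V$ and a set $E$ of subsets of $V$ (edges), each of cardinality at least $2$. The rank $r(\mathcal{G})$ is the maximum cardinality of an edge. Two distinct vertices are adjacent if some edge contains both. The adjacency matrix $A_{\mathcal{G}}$ has $(A_{\mathcal{G}})_{ij}=\sum_{e\in E,\, i,j\in e}\frac{1}{|e|-1}$ for $i\ne j$ and zero diagonal. A strong vertex coloring assigns colors to vertices so that any two adjacent vertices get different colors; the strong chromatic number $\gamma(\mathcal{G})$ is the minimum number of colors in a strong vertex coloring. -}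

module Defs where

open import Algebra.Bundles using (CommutativeMonoid)
import Algebra.Properties.AbelianGroup as AbelianGroupProperties
import Algebra.Properties.CommutativeSemigroup as CommutativeSemigroupProperties
open import Data.Bool using (if_then_else_)
open import Data.Fin using (Fin)
import Data.Fin as Fin
open import Data.Fin.Subset using (Subset; _∈_; ∣_∣)
open import Data.Fin.Subset.Properties using (_∈?_)
import Data.Integer as ℤ
open import Data.List using (List; foldr; map; filter)
open import Data.List.Membership.Propositional using () renaming (_∈_ to _∈ₗ_)
open import Data.List.Relation.Unary.All using (All)
open import Data.List.Relation.Unary.Unique.Propositional using (Unique)
open import Data.Nat using (ℕ; suc)
import Data.Nat as ℕ
import Data.Nat.Properties as ℕₚ
open import Data.Product using (Σ; ∃-syntax; _×_; _,_)
open import Data.Rational using (ℚ; 0ℚ; 1ℚ; ½; _+_; _*_; -_; _-_; _<_; _≤_; 1/_; _/_; positive; nonNegative; Positive)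
import Data.Rational as ℚ
import Data.Rational.Properties as ℚₚ
import Data.Vec.Functional as Vector
open import Data.Vec.Functional using (Vector)
open import Relation.Binary.PropositionalEquality using (_≡_; _≢_; sym; trans; cong; cong₂; subst; module ≡-Reasoning)
open import Relation.Nullary using (¬_; does)
open import Relation.Nullary.Decidable using (_×-dec_)

-- Reals are Cauchy sequences of rationals, taken up to the equivalence _≃ℝ_.
-- The existential is a Σ-type, so every real carries a modulus of convergence.
Cauchy : (ℕ → ℚ) → Set
Cauchy x = ∀ ε → 0ℚ < ε →
  ∃[ N ] (∀ m n → N ℕ.≤ m → N ℕ.≤ n → ℚ.∣ x m - x n ∣ < ε)

record ℝ : Set where
  constructor mkℝ
  field
    seq    : ℕ → ℚ
    cauchy : Cauchy seq

open ℝ public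

infix 4 _≃ℝ_ _≤ℝ_
infixl 6 _+ℝ_ _-ℝ_
infixl 7 _*ℝ_
infix 8 -ℝ_

_≃ℝ_ : ℝ → ℝ → Set
x ≃ℝ y = ∀ ε → 0ℚ < ε →
  ∃[ N ] (∀ n → N ℕ.≤ n → ℚ.∣ seq x n - seq y n ∣ < ε)

-- Non-strict order: the ε is needed because x may approach y from above.
_≤ℝ_ : ℝ → ℝ → Set
x ≤ℝ y = ∀ ε → 0ℚ < ε →
  ∃[ N ] (∀ n → N ℕ.≤ n → seq x n < seq y n + ε)

private
  open AbelianGroupProperties ℚₚ.+-0-abelianGroup using (xyx⁻¹≈y)
  open CommutativeSemigroupProperties
    (CommutativeMonoid.commutativeSemigroup ℚₚ.+-0-commutativeMonoid) using (interchange)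

  half-pos : ∀ {ε} → 0ℚ < ε → 0ℚ < ½ * ε
  half-pos {ε} 0<ε = ℚₚ.positive⁻¹ (½ * ε) {{ℚₚ.pos*pos⇒pos ½ ε {{positive 0<ε}}}}

  half+half : ∀ ε → ½ * ε + ½ * ε ≡ ε
  half+half ε = trans (sym (ℚₚ.*-distribʳ-+ ε ½ ½)) (ℚₚ.*-identityˡ ε)

  +-cauchy : ∀ {x y} → Cauchy x → Cauchy y → Cauchy (λ n → x n + y n)
  +-cauchy {x} {y} cx cy ε 0<ε =
    let Nx , hx = cx (½ * ε) (half-pos 0<ε)
        Ny , hy = cy (½ * ε) (half-pos 0<ε)
    in Nx ℕ.⊔ Ny , λ m n N≤m N≤n →
      let open ℚₚ.≤-Reasoning in begin-strict
        ℚ.∣ (x m + y m) - (x n + y n) ∣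
          ≡⟨ cong ℚ.∣_∣ (regroup (x m) (y m) (x n) (y n)) ⟩
        ℚ.∣ (x m - x n) + (y m - y n) ∣
          ≤⟨ ℚₚ.∣p+q∣≤∣p∣+∣q∣ (x m - x n) (y m - y n) ⟩
        ℚ.∣ x m - x n ∣ + ℚ.∣ y m - y n ∣
          <⟨ ℚₚ.+-mono-<
               (hx m n (ℕₚ.m⊔n≤o⇒m≤o Nx Ny N≤m) (ℕₚ.m⊔n≤o⇒m≤o Nx Ny N≤n))
               (hy m n (ℕₚ.m⊔n≤o⇒n≤o Nx Ny N≤m) (ℕₚ.m⊔n≤o⇒n≤o Nx Ny N≤n)) ⟩
        ½ * ε + ½ * ε
          ≡⟨ half+half ε ⟩
        ε ∎
    where
    regroup : ∀ a b c d → (a + b) - (c + d) ≡ (a - c) + (b - d)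
    regroup a b c d =
      trans (cong ((a + b) +_) (ℚₚ.neg-distrib-+ c d)) (interchange a b (- c) (- d))

  neg-cauchy : ∀ {x} → Cauchy x → Cauchy (λ n → - x n)
  neg-cauchy {x} cx ε 0<ε =
    let N , h = cx ε 0<ε
    in N , λ m n N≤m N≤n →
      subst (_< ε)
        (trans (sym (ℚₚ.∣-p∣≡∣p∣ (x m - x n)))
               (cong ℚ.∣_∣ (ℚₚ.neg-distrib-+ (x m) (- x n))))
        (h m n N≤m N≤n)

  eventuallyBounded : ∀ {x} → Cauchy x →
    ∃[ B ] (Positive B × ∃[ N ] (∀ n → N ℕ.≤ n → ℚ.∣ x n ∣ ≤ B))
  eventuallyBounded {x} cx =
    let N , h = cx 1ℚ (ℚₚ.positive⁻¹ 1ℚ)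
    in ℚ.∣ x N ∣ + 1ℚ
     , ℚₚ.nonNeg+pos⇒pos ℚ.∣ x N ∣ {{nonNegative (ℚₚ.0≤∣p∣ (x N))}} 1ℚ
     , N
     , λ n N≤n →
       let open ℚₚ.≤-Reasoning in begin
         ℚ.∣ x n ∣
           ≡⟨ cong ℚ.∣_∣ (split (x N) (x n)) ⟩
         ℚ.∣ x N + (x n - x N) ∣
           ≤⟨ ℚₚ.∣p+q∣≤∣p∣+∣q∣ (x N) (x n - x N) ⟩
         ℚ.∣ x N ∣ + ℚ.∣ x n - x N ∣
           ≤⟨ ℚₚ.+-monoʳ-≤ ℚ.∣ x N ∣ (ℚₚ.<⇒≤ (h n N N≤n ℕₚ.≤-refl)) ⟩
         ℚ.∣ x N ∣ + 1ℚ ∎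
    where
    split : ∀ a b → b ≡ a + (b - a)
    split a b = sym (trans (sym (ℚₚ.+-assoc a b (- a))) (xyx⁻¹≈y a b))

  recip : ∀ B → Positive B → ℚ
  recip B B⁺ = (1/ B) {{ℚₚ.pos⇒nonZero B {{B⁺}}}}

  scaled-bound : ∀ {a d} B (B⁺ : Positive B) ε → ℚ.∣ a ∣ ≤ B →
    ℚ.∣ d ∣ < recip B B⁺ * ε → ℚ.∣ a * d ∣ < ε
  scaled-bound {a} {d} B B⁺ ε a≤B d<ε/B = begin-strict
    ℚ.∣ a * d ∣              ≡⟨ ℚₚ.∣p*q∣≡∣p∣*∣q∣ a d ⟩
    ℚ.∣ a ∣ * ℚ.∣ d ∣        ≤⟨ ℚₚ.*-monoʳ-≤-nonNeg ℚ.∣ d ∣ {{nonNegative (ℚₚ.0≤∣p∣ d)}} a≤B ⟩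
    B * ℚ.∣ d ∣              <⟨ ℚₚ.*-monoʳ-<-pos B {{B⁺}} d<ε/B ⟩
    B * (recip B B⁺ * ε)     ≡⟨ sym (ℚₚ.*-assoc B (recip B B⁺) ε) ⟩
    (B * recip B B⁺) * ε     ≡⟨ cong (_* ε) (ℚₚ.*-inverseʳ B {{ℚₚ.pos⇒nonZero B {{B⁺}}}}) ⟩
    1ℚ * ε                   ≡⟨ ℚₚ.*-identityˡ ε ⟩
    ε ∎
    where open ℚₚ.≤-Reasoning

  scaled-pos : ∀ B (B⁺ : Positive B) {ε} → 0ℚ < ε → 0ℚ < recip B B⁺ * ε
  scaled-pos B B⁺ {ε} 0<ε =
    ℚₚ.positive⁻¹ (recip B B⁺ * ε)
      {{ℚₚ.pos*pos⇒pos (recip B B⁺) {{ℚₚ.1/pos⇒pos B {{B⁺}}}} ε {{positive 0<ε}}}}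

  product-small : (x y : ℕ → ℚ) (ε Bx : ℚ) (Bx⁺ : Positive Bx) (By : ℚ) (By⁺ : Positive By)
    (Mx My Nx Ny : ℕ) →
    (∀ n → Mx ℕ.≤ n → ℚ.∣ x n ∣ ≤ Bx) → (∀ n → My ℕ.≤ n → ℚ.∣ y n ∣ ≤ By) →
    (∀ m n → Nx ℕ.≤ m → Nx ℕ.≤ n → ℚ.∣ x m - x n ∣ < recip By By⁺ * (½ * ε)) →
    (∀ m n → Ny ℕ.≤ m → Ny ℕ.≤ n → ℚ.∣ y m - y n ∣ < recip Bx Bx⁺ * (½ * ε)) →
    ∃[ N ] (∀ m n → N ℕ.≤ m → N ℕ.≤ n → ℚ.∣ x m * y m - x n * y n ∣ < ε)
  product-small x y ε Bx Bx⁺ By By⁺ Mx My Nx Ny bx by hx hy =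
    (Mx ℕ.⊔ My) ℕ.⊔ (Nx ℕ.⊔ Ny) , λ m n N≤m N≤n →
      let open ℚₚ.≤-Reasoning in begin-strict
        ℚ.∣ x m * y m - x n * y n ∣
          ≡⟨ cong ℚ.∣_∣ (regroup (x m) (y m) (x n) (y n)) ⟩
        ℚ.∣ x m * (y m - y n) + y n * (x m - x n) ∣
          ≤⟨ ℚₚ.∣p+q∣≤∣p∣+∣q∣ (x m * (y m - y n)) (y n * (x m - x n)) ⟩
        ℚ.∣ x m * (y m - y n) ∣ + ℚ.∣ y n * (x m - x n) ∣
          <⟨ ℚₚ.+-mono-<
               (scaled-bound {x m} {y m - y n} Bx Bx⁺ (½ * ε)
                 (bx m (Mx≤ N≤m)) (hy m n (Ny≤ N≤m) (Ny≤ N≤n)))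
               (scaled-bound {y n} {x m - x n} By By⁺ (½ * ε)
                 (by n (My≤ N≤n)) (hx m n (Nx≤ N≤m) (Nx≤ N≤n))) ⟩
        ½ * ε + ½ * ε
          ≡⟨ half+half ε ⟩
        ε ∎
    where
    regroup : ∀ a b c d → a * b - c * d ≡ a * (b - d) + d * (a - c)
    regroup a b c d = sym (begin
      a * (b - d) + d * (a - c)
        ≡⟨ cong₂ _+_ (ℚₚ.*-distribˡ-+ a b (- d)) (ℚₚ.*-distribˡ-+ d a (- c)) ⟩
      (a * b + a * - d) + (d * a + d * - c)
        ≡⟨ cong₂ (λ u v → (a * b + u) + (v + d * - c))
             (sym (ℚₚ.neg-distribʳ-* a d)) (ℚₚ.*-comm d a) ⟩
      (a * b - a * d) + (a * d + d * - c)
        ≡⟨ ℚₚ.+-assoc (a * b) (- (a * d)) (a * d + d * - c) ⟩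
      a * b + (- (a * d) + (a * d + d * - c))
        ≡⟨ cong (a * b +_) (sym (ℚₚ.+-assoc (- (a * d)) (a * d) (d * - c))) ⟩
      a * b + ((- (a * d) + a * d) + d * - c)
        ≡⟨ cong (λ u → a * b + (u + d * - c)) (ℚₚ.+-inverseˡ (a * d)) ⟩
      a * b + (0ℚ + d * - c)
        ≡⟨ cong (a * b +_) (ℚₚ.+-identityˡ (d * - c)) ⟩
      a * b + d * - c
        ≡⟨ cong (a * b +_) (trans (sym (ℚₚ.neg-distribʳ-* d c)) (cong -_ (ℚₚ.*-comm d c))) ⟩
      a * b - c * d ∎)
      where open ≡-Reasoning

    Mx≤ : ∀ {k} → (Mx ℕ.⊔ My) ℕ.⊔ (Nx ℕ.⊔ Ny) ℕ.≤ k → Mx ℕ.≤ k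
    Mx≤ p = ℕₚ.m⊔n≤o⇒m≤o Mx My (ℕₚ.m⊔n≤o⇒m≤o (Mx ℕ.⊔ My) (Nx ℕ.⊔ Ny) p)

    My≤ : ∀ {k} → (Mx ℕ.⊔ My) ℕ.⊔ (Nx ℕ.⊔ Ny) ℕ.≤ k → My ℕ.≤ k
    My≤ p = ℕₚ.m⊔n≤o⇒n≤o Mx My (ℕₚ.m⊔n≤o⇒m≤o (Mx ℕ.⊔ My) (Nx ℕ.⊔ Ny) p)

    Nx≤ : ∀ {k} → (Mx ℕ.⊔ My) ℕ.⊔ (Nx ℕ.⊔ Ny) ℕ.≤ k → Nx ℕ.≤ k
    Nx≤ p = ℕₚ.m⊔n≤o⇒m≤o Nx Ny (ℕₚ.m⊔n≤o⇒n≤o (Mx ℕ.⊔ My) (Nx ℕ.⊔ Ny) p)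

    Ny≤ : ∀ {k} → (Mx ℕ.⊔ My) ℕ.⊔ (Nx ℕ.⊔ Ny) ℕ.≤ k → Ny ℕ.≤ k
    Ny≤ p = ℕₚ.m⊔n≤o⇒n≤o Nx Ny (ℕₚ.m⊔n≤o⇒n≤o (Mx ℕ.⊔ My) (Nx ℕ.⊔ Ny) p)

  *-cauchy : ∀ {x y} → Cauchy x → Cauchy y → Cauchy (λ n → x n * y n)
  *-cauchy {x} {y} cx cy ε 0<ε =
    let Bx , Bx⁺ , Mx , bx = eventuallyBounded {x} cx
        By , By⁺ , My , by = eventuallyBounded {y} cy
        Nx , hx = cx (recip By By⁺ * (½ * ε)) (scaled-pos By By⁺ {½ * ε} (half-pos {ε} 0<ε))
        Ny , hy = cy (recip Bx Bx⁺ * (½ * ε)) (scaled-pos Bx Bx⁺ {½ * ε} (half-pos {ε} 0<ε))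
    in product-small x y ε Bx Bx⁺ By By⁺ Mx My Nx Ny bx by hx hy

fromℚ : ℚ → ℝ
fromℚ q = mkℝ (λ _ → q) λ ε 0<ε →
  0 , λ _ _ _ _ → subst (λ d → ℚ.∣ d ∣ < ε) (sym (ℚₚ.+-inverseʳ q)) 0<ε

fromℕ : ℕ → ℝ
fromℕ k = fromℚ (ℤ.+ k / 1)

0ℝ 1ℝ : ℝ
0ℝ = fromℚ 0ℚ
1ℝ = fromℚ 1ℚ

_+ℝ_ : ℝ → ℝ → ℝ
x +ℝ y = mkℝ (λ n → seq x n + seq y n) (+-cauchy {seq x} {seq y} (cauchy x) (cauchy y))

-ℝ_ : ℝ → ℝ
-ℝ x = mkℝ (λ n → - seq x n) (neg-cauchy {seq x} (cauchy x))

_-ℝ_ : ℝ → ℝ → ℝ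
x -ℝ y = x +ℝ (-ℝ y)

_*ℝ_ : ℝ → ℝ → ℝ
x *ℝ y = mkℝ (λ n → seq x n * seq y n) (*-cauchy {seq x} {seq y} (cauchy x) (cauchy y))

Matrix : ℕ → Set
Matrix n = Fin n → Fin n → ℝ

sumℝ : ∀ {n} → Vector ℝ n → ℝ
sumℝ = Vector.foldr _+ℝ_ 0ℝ

_·ᵥ_ : ∀ {n} → Matrix n → Vector ℝ n → Vector ℝ n
(A ·ᵥ x) i = sumℝ (λ j → A i j *ℝ x j)

IsEigenvalue : ∀ {n} → Matrix n → ℝ → Set
IsEigenvalue {n} A μ = Σ (Vector ℝ n) λ x →
  (¬ (∀ i → x i ≃ℝ 0ℝ)) × (∀ i → (A ·ᵥ x) i ≃ℝ μ *ℝ x i)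

-- Only real eigenvalues are considered; for a real symmetric matrix these are
-- all of them.
IsLargestEigenvalue : ∀ {n} → Matrix n → ℝ → Set
IsLargestEigenvalue A μ = IsEigenvalue A μ × (∀ ν → IsEigenvalue A ν → ν ≤ℝ μ)

-- The vertex set is Fin n.  The set of edges is a duplicate-free list;
-- nothing below depends on its order.
record Hypergraph (n : ℕ) : Set where
  field
    edges      : List (Subset n)
    distinct   : Unique edges
    edgeSize≥2 : All (λ e → 2 ℕ.≤ ∣ e ∣) edges

open Hypergraph public

-- With the convention that an edgeless hypergraph has rank 0.
rank : ∀ {n} → Hypergraph n → ℕ
rank G = foldr ℕ._⊔_ 0 (map ∣_∣ (edges G))

Adjacent : ∀ {n} → Hypergraph n → Fin n → Fin n → Set
Adjacent G i j = i ≢ j × ∃[ e ] (e ∈ₗ edges G × i ∈ e × j ∈ e)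

-- k ↦ 1 / (k - 1); the value for k < 2 is never used, by edgeSize≥2.
1/[_-1] : ℕ → ℚ
1/[ suc (suc k) -1] = ℤ.+ 1 / suc k
1/[ _ -1]           = 0ℚ

adjacencyEntry : ∀ {n} → Hypergraph n → Fin n → Fin n → ℚ
adjacencyEntry G i j =
  if does (i Fin.≟ j) then 0ℚ
  else foldr _+_ 0ℚ (map (λ e → 1/[ ∣ e ∣ -1])
         (filter (λ e → (i ∈? e) ×-dec (j ∈? e)) (edges G)))

adjacencyMatrix : ∀ {n} → Hypergraph n → Matrix n
adjacencyMatrix G i j = fromℚ (adjacencyEntry G i j)

IsStrongColoring : ∀ {n} → Hypergraph n → (k : ℕ) → (Fin n → Fin k) → Set
IsStrongColoring G k c = ∀ i j → Adjacent G i j → c i ≢ c j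

StronglyColorable : ∀ {n} → Hypergraph n → ℕ → Set
StronglyColorable {n} G k = Σ (Fin n → Fin k) (IsStrongColoring G k)

IsStrongChromaticNumber : ∀ {n} → Hypergraph n → ℕ → Set
IsStrongChromaticNumber G k =
  StronglyColorable G k × (∀ m → StronglyColorable G m → k ℕ.≤ m)

{-# OPTIONS --safe #-}
module Submission where

-- The adjacency graph of G contains a nonempty vertex set S in which every
-- vertex has at least γ - 1 neighbours inside S: otherwise greedy colouring
-- would use at most γ - 1 colours.  Adjacent vertices have entry at least
-- 1/(r - 1) in A, so the indicator vector of S shows that tI - A is not positive
-- definite for t = (γ - 1)/(r - 1).  It remains to find an eigenvalue ν ≥ t.
--
-- For rational q, positive definiteness of qI - A is decided by the signs of the
-- pivots of Gaussian elimination, so bisection yields a real ν at the threshold,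
-- represented by a sequence of rationals at which qI - A is infinitely often
-- semidefinite and infinitely often not definite.  Eliminating in νI - A over the
-- reals, either a pivot is positive, and we pass to the Schur complement, or it is
-- zero, and then semidefiniteness makes its row vanish and gives a kernel vector.
-- This case distinction is not decidable, so ν is only not not an eigenvalue;
-- that suffices because the order on the reals is stable under double negation.

open import Algebra.Bundles using (CommutativeRing)
open import Data.Bool using (Bool; true; false; not; if_then_else_)
open import Data.Empty using (⊥-elim)
open import Data.Fin using (Fin; zero; suc)
import Data.Fin as Fin
import Data.Fin.Properties as Finₚ
open import Data.Fin.Subset using (Subset; _∈_; ∣_∣; Nonempty) renaming (⊤ to full; _-_ to _∖_)
open import Data.Fin.Subset.Properties using (_∈?_; nonempty?; ∈⊤; x∈p∧x≢y⇒x∈p-y; x∈p⇒∣p-x∣<∣p∣)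
import Data.Integer as ℤ
import Data.Integer.Properties as ℤₚ
open import Data.List using (List; []; _∷_; length; filter; allFin; tabulate; foldr; map; lookup)
open import Data.List.Membership.Propositional using (lose; find) renaming (_∈_ to _∈ₗ_; _∉_ to _∉ₗ_)
open import Data.List.Membership.Propositional.Properties using (∈-filter⁺; ∈-map⁺; ∈-allFin)
open import Data.List.Properties using (filter-≐; length-map)
open import Data.List.Relation.Unary.All using () renaming (lookup to All-lookup)
open import Data.List.Relation.Unary.Any using (here; there; index) renaming (any? to anyₗ?)
open import Data.List.Relation.Unary.Any.Properties using (lookup-index)
open import Data.Nat using (ℕ; zero; suc)
import Data.Nat as ℕ
import Data.Nat.Coprimality as Coprimality
import Data.Nat.Properties as ℕₚ
open import Data.Product using (Σ; ∃-syntax; _×_; _,_; proj₁; proj₂; swap)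
open import Data.Rational using (ℚ; 0ℚ; 1ℚ; ½; _+_; _*_; -_; _-_; _<_; _≤_; 1/_; _/_; mkℚ; ↥_; positive; nonNegative)
import Data.Rational as ℚ
import Data.Rational.Properties as ℚₚ
open import Data.Rational.Solver using (module +-*-Solver)
open import Data.Sum using (_⊎_; inj₁; inj₂; [_,_]′)
open import Data.Unit using (⊤; tt)
open import Data.Vec.Functional using (Vector; head; tail) renaming (_∷_ to _∷ᵥ_)
open import Function using (_∘_; const)
open import Relation.Binary using (tri<; tri≈; tri>)
open import Relation.Binary.PropositionalEquality using (_≡_; _≢_; refl; sym; trans; cong; cong₂; subst; subst₂; module ≡-Reasoning)
open import Relation.Nullary using (¬_; Dec; yes; no; does)
open import Relation.Nullary.Decidable using (_×-dec_; ¬?; map′)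
open import Defs
open import Algebra.Properties.Semiring.Sum (CommutativeRing.semiring ℚₚ.+-*-commutativeRing)
open +-*-Solver using (solve; _:=_; con) renaming (_:+_ to _⊕_; _:*_ to _⊗_; :-_ to ⊝_; _:-_ to _⊖_)

-- Quadratic forms over ℚ

0≤+ : ∀ {p q} → 0ℚ ≤ p → 0ℚ ≤ q → 0ℚ ≤ p + q
0≤+ = ℚₚ.+-mono-≤ {0ℚ} {_} {0ℚ}

0≤* : ∀ {p q} → 0ℚ ≤ p → 0ℚ ≤ q → 0ℚ ≤ p * q
0≤* {p} {q} 0≤p 0≤q = ℚₚ.nonNegative⁻¹ (p * q)
  {{ℚₚ.nonNeg*nonNeg⇒nonNeg p {{nonNegative 0≤p}} q {{nonNegative 0≤q}}}}

0<* : ∀ {p q} → 0ℚ < p → 0ℚ < q → 0ℚ < p * q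
0<* {p} {q} 0<p 0<q = ℚₚ.positive⁻¹ (p * q)
  {{ℚₚ.pos*pos⇒pos p {{positive 0<p}} q {{positive 0<q}}}}

0≤p² : ∀ p → 0ℚ ≤ p * p
0≤p² p with ℚₚ.≤-total 0ℚ p
... | inj₁ 0≤p = 0≤* 0≤p 0≤p
... | inj₂ p≤0 = subst (0ℚ ≤_) (solve 1 (λ p → ⊝ p ⊗ ⊝ p := p ⊗ p) refl p)
                   (0≤* (ℚₚ.neg-antimono-≤ p≤0) (ℚₚ.neg-antimono-≤ p≤0))

p≤q⇒0≤q-p : ∀ {p q} → p ≤ q → 0ℚ ≤ q - p
p≤q⇒0≤q-p {p} {q} p≤q = subst (_≤ q - p) (ℚₚ.+-inverseʳ p) (ℚₚ.+-monoˡ-≤ (- p) p≤q)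

p<q⇒0<q-p : ∀ {p q} → p < q → 0ℚ < q - p
p<q⇒0<q-p {p} {q} p<q = subst (_< q - p) (ℚₚ.+-inverseʳ p) (ℚₚ.+-monoˡ-< (- p) p<q)

q≡p+d⇒p≤q : ∀ {p q d} → q ≡ p + d → 0ℚ ≤ d → p ≤ q
q≡p+d⇒p≤q {p} {q} {d} q≡p+d 0≤d = begin
  p        ≡⟨ ℚₚ.+-identityʳ p ⟨
  p + 0ℚ   ≤⟨ ℚₚ.+-monoʳ-≤ p 0≤d ⟩
  p + d    ≡⟨ q≡p+d ⟨
  q ∎
  where open ℚₚ.≤-Reasoning

q≡p+d⇒p<q : ∀ {p q d} → q ≡ p + d → 0ℚ < d → p < q
q≡p+d⇒p<q {p} {q} {d} q≡p+d 0<d = begin-strict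
  p        ≡⟨ ℚₚ.+-identityʳ p ⟨
  p + 0ℚ   <⟨ ℚₚ.+-monoʳ-< p 0<d ⟩
  p + d    ≡⟨ q≡p+d ⟨
  q ∎
  where open ℚₚ.≤-Reasoning

p²≤0⇒p≡0 : ∀ {p} → p * p ≤ 0ℚ → p ≡ 0ℚ
p²≤0⇒p≡0 {p} p²≤0 with ℚₚ.<-cmp 0ℚ p
... | tri< 0<p _ _ = ⊥-elim (ℚₚ.<-irrefl refl (ℚₚ.<-≤-trans (0<* 0<p 0<p) p²≤0))
... | tri≈ _ 0≡p _ = sym 0≡p
... | tri> _ _ p<0 = ⊥-elim (ℚₚ.<-irrefl refl (ℚₚ.<-≤-trans
        (subst (0ℚ <_) (solve 1 (λ p → ⊝ p ⊗ ⊝ p := p ⊗ p) refl p)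
           (0<* (ℚₚ.neg-antimono-< p<0) (ℚₚ.neg-antimono-< p<0))) p²≤0))

module _ {a : ℚ} (0<a : 0ℚ < a) where
  private instance
    a≢0 : ℚ.NonZero a
    a≢0 = ℚₚ.pos⇒nonZero a {{positive 0<a}}

  recip : ℚ
  recip = 1/ a

  0<recip : 0ℚ < recip
  0<recip = ℚₚ.positive⁻¹ (1/ a) {{ℚₚ.1/pos⇒pos a {{positive 0<a}}}}

  *-recip : a * recip ≡ 1ℚ
  *-recip = ℚₚ.*-inverseʳ a

  0≤a*p⇒0≤p : ∀ {p} → 0ℚ ≤ a * p → 0ℚ ≤ p
  0≤a*p⇒0≤p {p} 0≤ap = ℚₚ.*-cancelˡ-≤-pos a {{positive 0<a}}
    (subst (_≤ a * p) (sym (ℚₚ.*-zeroʳ a)) 0≤ap)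

sum-mono : ∀ {n} {f g : Vector ℚ n} → (∀ i → f i ≤ g i) → sum f ≤ sum g
sum-mono {zero}  f≤g = ℚₚ.≤-refl
sum-mono {suc n} f≤g = ℚₚ.+-mono-≤ (f≤g zero) (sum-mono (f≤g ∘ suc))

0≤sum : ∀ {n} {f : Vector ℚ n} → (∀ i → 0ℚ ≤ f i) → 0ℚ ≤ sum f
0≤sum {zero}  0≤f = ℚₚ.≤-refl
0≤sum {suc n} 0≤f = 0≤+ (0≤f zero) (0≤sum (0≤f ∘ suc))

term≤sum : ∀ {n} {f : Vector ℚ n} → (∀ i → 0ℚ ≤ f i) → ∀ i → f i ≤ sum f
term≤sum {suc n} {f} 0≤f zero    = q≡p+d⇒p≤q refl (0≤sum (0≤f ∘ suc))
term≤sum {suc n} {f} 0≤f (suc i) = ℚₚ.≤-trans (term≤sum (0≤f ∘ suc) i)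
  (q≡p+d⇒p≤q (ℚₚ.+-comm (f zero) _) (0≤f zero))

sum-linear : ∀ {n} p q (f g : Vector ℚ n) →
  sum (λ i → p * f i + q * g i) ≡ p * sum f + q * sum g
sum-linear p q f g = trans (∑-distrib-+ (λ i → p * f i) (λ i → q * g i))
  (sym (cong₂ _+_ (*-distribˡ-sum p f) (*-distribˡ-sum q g)))

δ : ∀ {n} → Fin n → Fin n → ℚ
δ zero    zero    = 1ℚ
δ zero    (suc _) = 0ℚ
δ (suc _) zero    = 0ℚ
δ (suc i) (suc j) = δ i j

sum-0* : ∀ {n} (f : Vector ℚ n) → sum (λ j → 0ℚ * f j) ≡ 0ℚ
sum-0* f = trans (sym (*-distribˡ-sum 0ℚ f)) (ℚₚ.*-zeroˡ (sum f))

sum-δ : ∀ {n} (i : Fin n) (f : Vector ℚ n) → sum (λ j → δ i j * f j) ≡ f i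
sum-δ zero    f = trans (cong₂ _+_ (ℚₚ.*-identityˡ (f zero)) (sum-0* (f ∘ suc))) (ℚₚ.+-identityʳ _)
sum-δ (suc i) f = trans (cong₂ _+_ (ℚₚ.*-zeroˡ (f zero)) (sum-δ i (f ∘ suc))) (ℚₚ.+-identityˡ _)

δ-sym : ∀ {n} (i j : Fin n) → δ i j ≡ δ j i
δ-sym zero    zero    = refl
δ-sym zero    (suc j) = refl
δ-sym (suc i) zero    = refl
δ-sym (suc i) (suc j) = δ-sym i j

Matrixℚ : ℕ → Set
Matrixℚ n = Fin n → Fin n → ℚ

Symmetric : ∀ {n} → Matrixℚ n → Set
Symmetric M = ∀ i j → M i j ≡ M j i

mulVec : ∀ {n} → Matrixℚ n → Vector ℚ n → Vector ℚ n
mulVec M x i = sum (λ j → M i j * x j)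

quad : ∀ {n} → Matrixℚ n → Vector ℚ n → ℚ
quad M x = sum (λ i → x i * mulVec M x i)

minor : ∀ {n} → Matrixℚ (suc n) → Matrixℚ n
minor M i j = M (suc i) (suc j)

-- The Schur complement of the top left entry, multiplied by that entry to avoid division.
schur : ∀ {n} → Matrixℚ (suc n) → Matrixℚ n
schur M i j = M zero zero * M (suc i) (suc j) - M (suc i) zero * M zero (suc j)

schur-sym : ∀ {n} {M : Matrixℚ (suc n)} → Symmetric M → Symmetric (schur M)
schur-sym {M = M} M-sym i j = cong₂ (λ u v → M zero zero * u - v) (M-sym (suc i) (suc j))
  (trans (cong₂ _*_ (M-sym (suc i) zero) (M-sym zero (suc j))) (ℚₚ.*-comm (M zero (suc i)) (M (suc j) zero)))

row₀ : ∀ {n} → Matrixℚ (suc n) → Vector ℚ n → ℚ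
row₀ M y = sum (λ j → M zero (suc j) * y j)

mulVec-schur : ∀ {n} (M : Matrixℚ (suc n)) y i →
  mulVec (schur M) y i ≡ M zero zero * mulVec (minor M) y i - M (suc i) zero * row₀ M y
mulVec-schur M y i = begin
  mulVec (schur M) y i
    ≡⟨ sum-cong-≗ (λ j → solve 5 (λ a c d b y → (a ⊗ c ⊖ d ⊗ b) ⊗ y := a ⊗ (c ⊗ y) ⊕ (⊝ d) ⊗ (b ⊗ y)) refl
         (M zero zero) (M (suc i) (suc j)) (M (suc i) zero) (M zero (suc j)) (y j)) ⟩
  sum (λ j → M zero zero * (M (suc i) (suc j) * y j) + (- M (suc i) zero) * (M zero (suc j) * y j))
    ≡⟨ sum-linear (M zero zero) (- M (suc i) zero) (λ j → minor M i j * y j) (λ j → M zero (suc j) * y j) ⟩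
  M zero zero * mulVec (minor M) y i + (- M (suc i) zero) * row₀ M y
    ≡⟨ cong (M zero zero * mulVec (minor M) y i +_) (sym (ℚₚ.neg-distribˡ-* (M (suc i) zero) (row₀ M y))) ⟩
  M zero zero * mulVec (minor M) y i - M (suc i) zero * row₀ M y ∎
  where open ≡-Reasoning

module _ {n} {M : Matrixℚ (suc n)} (M-sym : Symmetric M) where

  col₀≡row₀ : ∀ y → sum (λ i → y i * M (suc i) zero) ≡ row₀ M y
  col₀≡row₀ y = sum-cong-≗ (λ i → trans (ℚₚ.*-comm (y i) _) (cong (_* y i) (M-sym (suc i) zero)))

  quad-split : ∀ x₀ y → quad M (x₀ ∷ᵥ y) ≡
    x₀ * (M zero zero * x₀ + row₀ M y) + (x₀ * row₀ M y + quad (minor M) y)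
  quad-split x₀ y = cong (x₀ * (M zero zero * x₀ + row₀ M y) +_) (begin
    sum (λ i → y i * (M (suc i) zero * x₀ + mulVec (minor M) y i))
      ≡⟨ sum-cong-≗ (λ i → solve 4 (λ y c x r → y ⊗ (c ⊗ x ⊕ r) := x ⊗ (y ⊗ c) ⊕ con 1ℚ ⊗ (y ⊗ r)) refl
           (y i) (M (suc i) zero) x₀ (mulVec (minor M) y i)) ⟩
    sum (λ i → x₀ * (y i * M (suc i) zero) + 1ℚ * (y i * mulVec (minor M) y i))
      ≡⟨ sum-linear x₀ 1ℚ (λ i → y i * M (suc i) zero) (λ i → y i * mulVec (minor M) y i) ⟩
    x₀ * sum (λ i → y i * M (suc i) zero) + 1ℚ * quad (minor M) y
      ≡⟨ cong₂ (λ u v → x₀ * u + v) (col₀≡row₀ y) (ℚₚ.*-identityˡ _) ⟩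
    x₀ * row₀ M y + quad (minor M) y ∎)
    where open ≡-Reasoning

  quad-schur : ∀ y → quad (schur M) y ≡ M zero zero * quad (minor M) y - row₀ M y * row₀ M y
  quad-schur y = begin
    sum (λ i → y i * mulVec (schur M) y i)
      ≡⟨ sum-cong-≗ (λ i → trans (cong (y i *_) (mulVec-schur M y i))
           (solve 5 (λ y a r c β → y ⊗ (a ⊗ r ⊖ c ⊗ β) := a ⊗ (y ⊗ r) ⊕ (⊝ β) ⊗ (y ⊗ c)) refl
             (y i) (M zero zero) (mulVec (minor M) y i) (M (suc i) zero) (row₀ M y))) ⟩
    sum (λ i → M zero zero * (y i * mulVec (minor M) y i) + (- row₀ M y) * (y i * M (suc i) zero))
      ≡⟨ sum-linear (M zero zero) (- row₀ M y) (λ i → y i * mulVec (minor M) y i) (λ i → y i * M (suc i) zero) ⟩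
    M zero zero * quad (minor M) y + (- row₀ M y) * sum (λ i → y i * M (suc i) zero)
      ≡⟨ cong (λ u → M zero zero * quad (minor M) y + (- row₀ M y) * u) (col₀≡row₀ y) ⟩
    M zero zero * quad (minor M) y + (- row₀ M y) * row₀ M y
      ≡⟨ cong (M zero zero * quad (minor M) y +_) (sym (ℚₚ.neg-distribˡ-* (row₀ M y) (row₀ M y))) ⟩
    M zero zero * quad (minor M) y - row₀ M y * row₀ M y ∎
    where open ≡-Reasoning

  -- Multiplying by the pivot clears the division by it. The identity is used in both directions:
  -- the square is nonnegative, and a suitable `x₀` makes it vanish.
  completing-the-square : ∀ x₀ y → M zero zero * quad M (x₀ ∷ᵥ y) ≡
    (M zero zero * x₀ + row₀ M y) * (M zero zero * x₀ + row₀ M y) + quad (schur M) y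
  completing-the-square x₀ y = begin
    a * quad M (x₀ ∷ᵥ y)
      ≡⟨ cong (a *_) (quad-split x₀ y) ⟩
    a * (x₀ * (a * x₀ + β) + (x₀ * β + c))
      ≡⟨ solve 4 (λ a x β c → a ⊗ (x ⊗ (a ⊗ x ⊕ β) ⊕ (x ⊗ β ⊕ c)) :=
           (a ⊗ x ⊕ β) ⊗ (a ⊗ x ⊕ β) ⊕ (a ⊗ c ⊖ β ⊗ β)) refl a x₀ β c ⟩
    (a * x₀ + β) * (a * x₀ + β) + (a * c - β * β)
      ≡⟨ cong ((a * x₀ + β) * (a * x₀ + β) +_) (quad-schur y) ⟨
    (a * x₀ + β) * (a * x₀ + β) + quad (schur M) y ∎
    where
    open ≡-Reasoning
    a = M zero zero
    β = row₀ M y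
    c = quad (minor M) y

PSD : ∀ {n} → Matrixℚ n → Set
PSD M = ∀ x → 0ℚ ≤ quad M x

-- For symmetric matrices this is a decidable form of positive definiteness. The scaling in `schur`
-- multiplies later pivots by positive factors as long as the earlier ones are positive, so up to
-- the first failure the signs are those of ordinary elimination.
PositivePivots : ∀ {n} → Matrixℚ n → Set
PositivePivots {zero}  M = ⊤
PositivePivots {suc n} M = 0ℚ < M zero zero × PositivePivots (schur M)

positivePivots? : ∀ {n} (M : Matrixℚ n) → Dec (PositivePivots M)
positivePivots? {zero}  M = yes tt
positivePivots? {suc n} M = (0ℚ ℚₚ.<? M zero zero) ×-dec positivePivots? (schur M)

positivePivots⇒PSD : ∀ {n} {M : Matrixℚ n} → Symmetric M → PositivePivots M → PSD M
positivePivots⇒PSD {zero}  M-sym _            x = ℚₚ.≤-refl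
positivePivots⇒PSD {suc n} {M} M-sym (0<a , good) x = 0≤a*p⇒0≤p 0<a
  (subst (0ℚ ≤_) (sym (completing-the-square M-sym (head x) (tail x)))
    (0≤+ (0≤p² (M zero zero * head x + row₀ M (tail x))) (positivePivots⇒PSD (schur-sym M-sym) good (tail x))))

-- If the form is nonpositive at `x`, then so is a square plus the form of the Schur complement at
-- the tail. Both summands are nonnegative, so by induction the tail vanishes; then the square
-- vanishes too, and dividing by the pivot gives the head.
positivePivots⇒definite : ∀ {n} {M : Matrixℚ n} → Symmetric M → PositivePivots M →
  ∀ x → quad M x ≤ 0ℚ → ∀ i → x i ≡ 0ℚ
positivePivots⇒definite {suc n} {M} M-sym (0<a , good) x q≤0 = x≡0
  where
  a = M zero zero
  y = tail x
  β = row₀ M y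
  s = a * head x + β

  s²+q≤0 : s * s + quad (schur M) y ≤ 0ℚ
  s²+q≤0 = subst₂ _≤_ (completing-the-square M-sym (head x) y) (ℚₚ.*-zeroʳ a)
    (ℚₚ.*-monoˡ-≤-nonNeg a {{nonNegative (ℚₚ.<⇒≤ 0<a)}} q≤0)

  y≡0 : ∀ i → y i ≡ 0ℚ
  y≡0 = positivePivots⇒definite (schur-sym M-sym) good y
    (ℚₚ.≤-trans (q≡p+d⇒p≤q (ℚₚ.+-comm (s * s) _) (0≤p² s)) s²+q≤0)

  β≡0 : β ≡ 0ℚ
  β≡0 = trans (sum-cong-≗ (λ j → trans (cong (M zero (suc j) *_) (y≡0 j)) (ℚₚ.*-comm (M zero (suc j)) 0ℚ)))
    (sum-0* (λ j → M zero (suc j)))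

  s≡0 : s ≡ 0ℚ
  s≡0 = p²≤0⇒p≡0 (ℚₚ.≤-trans
    (q≡p+d⇒p≤q refl (positivePivots⇒PSD (schur-sym M-sym) good y)) s²+q≤0)

  x₀≡0 : head x ≡ 0ℚ
  x₀≡0 = begin
    head x                       ≡⟨ ℚₚ.*-identityˡ (head x) ⟨
    1ℚ * head x                  ≡⟨ cong (_* head x) (*-recip 0<a) ⟨
    (a * recip 0<a) * head x    
      ≡⟨ solve 4 (λ a r x β → (a ⊗ r) ⊗ x := r ⊗ (a ⊗ x ⊕ β) ⊖ r ⊗ β) refl a (recip 0<a) (head x) β ⟩
    recip 0<a * s - recip 0<a * β  ≡⟨ cong₂ (λ u v → recip 0<a * u - recip 0<a * v) s≡0 β≡0 ⟩
    recip 0<a * 0ℚ - recip 0<a * 0ℚ  ≡⟨ ℚₚ.+-inverseʳ (recip 0<a * 0ℚ) ⟩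
    0ℚ ∎
    where open ≡-Reasoning

  x≡0 : ∀ i → x i ≡ 0ℚ
  x≡0 zero    = x₀≡0
  x≡0 (suc i) = y≡0 i

-- For a given tail, the head `- β / a` annihilates the square, so the form of the Schur complement
-- is the pivot times a value of the form of `M`.
schur-PSD : ∀ {n} {M : Matrixℚ (suc n)} → Symmetric M → 0ℚ < M zero zero → PSD M → PSD (schur M)
schur-PSD {M = M} M-sym 0<a psd y = subst (0ℚ ≤_) aq≡q (0≤* (ℚₚ.<⇒≤ 0<a) (psd (x₀ ∷ᵥ y)))
  where
  open ≡-Reasoning
  a = M zero zero
  β = row₀ M y
  r = recip 0<a
  x₀ = - (r * β)

  s≡0 : a * x₀ + β ≡ 0ℚ
  s≡0 = begin
    a * (- (r * β)) + β   ≡⟨ solve 3 (λ a r β → a ⊗ (⊝ (r ⊗ β)) ⊕ β := (con 1ℚ ⊖ a ⊗ r) ⊗ β) refl a r β ⟩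
    (1ℚ - a * r) * β      ≡⟨ cong (λ u → (1ℚ - u) * β) (*-recip 0<a) ⟩
    (1ℚ - 1ℚ) * β         ≡⟨ ℚₚ.*-zeroˡ β ⟩
    0ℚ ∎

  aq≡q : a * quad M (x₀ ∷ᵥ y) ≡ quad (schur M) y
  aq≡q = begin
    a * quad M (x₀ ∷ᵥ y)                               ≡⟨ completing-the-square M-sym x₀ y ⟩
    (a * x₀ + β) * (a * x₀ + β) + quad (schur M) y    ≡⟨ cong (λ u → u * u + quad (schur M) y) s≡0 ⟩
    0ℚ + quad (schur M) y                             ≡⟨ ℚₚ.+-identityˡ _ ⟩
    quad (schur M) y ∎

module _ {n} {M : Matrixℚ (suc n)} (M-sym : Symmetric M) (psd : PSD M) where

  private
    a = M zero zero

    row₀-δ : ∀ j → row₀ M (δ j) ≡ M zero (suc j)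
    row₀-δ j = trans (sum-cong-≗ (λ k → ℚₚ.*-comm (M zero (suc k)) (δ j k))) (sum-δ j (λ k → M zero (suc k)))

    quad-δ : ∀ j → quad (minor M) (δ j) ≡ M (suc j) (suc j)
    quad-δ j = trans (sum-δ j (mulVec (minor M) (δ j)))
      (trans (sum-cong-≗ (λ k → ℚₚ.*-comm (minor M j k) (δ j k))) (sum-δ j (minor M j)))

  -- The pivot is the value of the form at the first basis vector.
  PSD⇒0≤pivot : 0ℚ ≤ a
  PSD⇒0≤pivot = subst (0ℚ ≤_) eq (psd (1ℚ ∷ᵥ λ _ → 0ℚ))
    where
    β≡0 : row₀ M (λ _ → 0ℚ) ≡ 0ℚ
    β≡0 = trans (sum-cong-≗ (λ j → ℚₚ.*-comm (M zero (suc j)) 0ℚ)) (sum-0* (λ j → M zero (suc j)))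

    eq : quad M (1ℚ ∷ᵥ λ _ → 0ℚ) ≡ a
    eq = trans (quad-split M-sym 1ℚ (λ _ → 0ℚ))
      (trans (cong₂ (λ u v → 1ℚ * (a * 1ℚ + u) + (1ℚ * u + v)) β≡0 (sum-0* (mulVec (minor M) (λ _ → 0ℚ))))
        (solve 1 (λ a → con 1ℚ ⊗ (a ⊗ con 1ℚ ⊕ con 0ℚ) ⊕ (con 1ℚ ⊗ con 0ℚ ⊕ con 0ℚ) := a) refl a))

  -- Evaluate the quadratic form at (- k b, e_j), where b is the j-th entry of row 0 after the pivot.
  PSD⇒row-bound : ∀ j k → 0ℚ ≤ k → a * k ≤ 1ℚ →
    k * (M zero (suc j) * M zero (suc j)) ≤ M (suc j) (suc j)
  PSD⇒row-bound j k 0≤k ak≤1 = q≡p+d⇒p≤q eq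
    (0≤+ (psd (- (k * b) ∷ᵥ δ j)) (0≤* (0≤* 0≤k (p≤q⇒0≤q-p ak≤1)) (0≤p² b)))
    where
    b = M zero (suc j)
    c = M (suc j) (suc j)

    eq : c ≡ k * (b * b) + (quad M (- (k * b) ∷ᵥ δ j) + k * (1ℚ - a * k) * (b * b))
    eq = sym (trans
      (cong (λ u → k * (b * b) + (u + k * (1ℚ - a * k) * (b * b)))
        (trans (quad-split M-sym (- (k * b)) (δ j))
          (cong₂ (λ u v → - (k * b) * (a * - (k * b) + u) + (- (k * b) * u + v)) (row₀-δ j) (quad-δ j))))
      (solve 4 (λ a b c k → k ⊗ (b ⊗ b) ⊕ (((⊝ (k ⊗ b)) ⊗ (a ⊗ (⊝ (k ⊗ b)) ⊕ b) ⊕ ((⊝ (k ⊗ b)) ⊗ b ⊕ c))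
          ⊕ k ⊗ (con 1ℚ ⊖ a ⊗ k) ⊗ (b ⊗ b)) := c) refl a b c k))

-- The matrices tI - A

shift : ∀ {n} → Matrixℚ n → ℚ → Matrixℚ n
shift A t i j = t * δ i j - A i j

shift-sym : ∀ {n} {A : Matrixℚ n} → Symmetric A → ∀ t → Symmetric (shift A t)
shift-sym A-sym t i j = cong₂ (λ u v → t * u - v) (δ-sym i j) (A-sym i j)

mulVec-shift : ∀ {n} (A : Matrixℚ n) t x i → mulVec (shift A t) x i ≡ t * x i - mulVec A x i
mulVec-shift A t x i = begin
  sum (λ j → (t * δ i j - A i j) * x j)
    ≡⟨ sum-cong-≗ (λ j → solve 4 (λ t d a x → (t ⊗ d ⊖ a) ⊗ x := t ⊗ (d ⊗ x) ⊕ (⊝ con 1ℚ) ⊗ (a ⊗ x)) refl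
         t (δ i j) (A i j) (x j)) ⟩
  sum (λ j → t * (δ i j * x j) + (- 1ℚ) * (A i j * x j))
    ≡⟨ sum-linear t (- 1ℚ) (λ j → δ i j * x j) (λ j → A i j * x j) ⟩
  t * sum (λ j → δ i j * x j) + (- 1ℚ) * mulVec A x i
    ≡⟨ cong₂ (λ u v → t * u + v) (sum-δ i x) (solve 1 (λ q → (⊝ con 1ℚ) ⊗ q := ⊝ q) refl (mulVec A x i)) ⟩
  t * x i - mulVec A x i ∎
  where open ≡-Reasoning

quad-shift : ∀ {n} (A : Matrixℚ n) t x → quad (shift A t) x ≡ t * sum (λ i → x i * x i) - quad A x
quad-shift A t x = begin
  sum (λ i → x i * mulVec (shift A t) x i)
    ≡⟨ sum-cong-≗ (λ i → trans (cong (x i *_) (mulVec-shift A t x i))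
         (solve 3 (λ t x m → x ⊗ (t ⊗ x ⊖ m) := t ⊗ (x ⊗ x) ⊕ (⊝ con 1ℚ) ⊗ (x ⊗ m)) refl t (x i) (mulVec A x i))) ⟩
  sum (λ i → t * (x i * x i) + (- 1ℚ) * (x i * mulVec A x i))
    ≡⟨ sum-linear t (- 1ℚ) (λ i → x i * x i) (λ i → x i * mulVec A x i) ⟩
  t * sum (λ i → x i * x i) + (- 1ℚ) * quad A x
    ≡⟨ cong (t * sum (λ i → x i * x i) +_) (solve 1 (λ q → (⊝ con 1ℚ) ⊗ q := ⊝ q) refl (quad A x)) ⟩
  t * sum (λ i → x i * x i) - quad A x ∎
  where open ≡-Reasoning

-- The arithmetic-geometric mean inequality, followed by bounding each of the two squares separately
-- by the whole sum; this covers `i` equal to `j` as well.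
product≤norm² : ∀ {n} (x : Vector ℚ n) i j → x i * x j ≤ sum (λ k → x k * x k)
product≤norm² x i j = begin
  x i * x j
    ≤⟨ q≡p+d⇒p≤q (solve 2 (λ p q → con ½ ⊗ (p ⊗ p ⊕ q ⊗ q) := p ⊗ q ⊕ con ½ ⊗ ((p ⊖ q) ⊗ (p ⊖ q))) refl (x i) (x j))
         (0≤* (ℚₚ.nonNegative⁻¹ ½) (0≤p² (x i - x j))) ⟩
  ½ * (x i * x i + x j * x j)
    ≤⟨ ℚₚ.*-monoˡ-≤-nonNeg ½ (ℚₚ.+-mono-≤ (term≤sum (λ k → 0≤p² (x k)) i) (term≤sum (λ k → 0≤p² (x k)) j)) ⟩
  ½ * (N + N)
    ≡⟨ solve 1 (λ p → con ½ ⊗ (p ⊕ p) := p) refl N ⟩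
  N ∎
  where
  open ℚₚ.≤-Reasoning
  N = sum (λ k → x k * x k)

total : ∀ {n} → Matrixℚ n → ℚ
total A = sum (λ i → sum (λ j → A i j))

-- The sum of all entries is a crude upper bound for the spectrum of a nonnegative matrix. It
-- supplies the right end of the first bisection interval.
shift-PSD : ∀ {n} {A : Matrixℚ n} → (∀ i j → 0ℚ ≤ A i j) → ∀ {t} → total A ≤ t → PSD (shift A t)
shift-PSD {A = A} 0≤A {t} A≤t x = subst (0ℚ ≤_) (sym (quad-shift A t x)) (p≤q⇒0≤q-p (begin
  sum (λ i → x i * mulVec A x i)
    ≡⟨ sum-cong-≗ (λ i → *-distribˡ-sum (x i) (λ j → A i j * x j)) ⟩
  sum (λ i → sum (λ j → x i * (A i j * x j)))
    ≤⟨ sum-mono (λ i → sum-mono (λ j → bound i j)) ⟩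
  sum (λ i → sum (λ j → A i j * N))
    ≡⟨ sum-cong-≗ (λ i → *-distribʳ-sum N (A i)) ⟨
  sum (λ i → sum (A i) * N)
    ≡⟨ *-distribʳ-sum N (λ i → sum (A i)) ⟨
  total A * N
    ≤⟨ ℚₚ.*-monoʳ-≤-nonNeg N {{nonNegative (0≤sum (λ i → 0≤p² (x i)))}} A≤t ⟩
  t * N ∎))
  where
  open ℚₚ.≤-Reasoning
  N = sum (λ k → x k * x k)

  bound : ∀ i j → x i * (A i j * x j) ≤ A i j * N
  bound i j = begin
    x i * (A i j * x j)   ≡⟨ solve 3 (λ p a q → p ⊗ (a ⊗ q) := a ⊗ (p ⊗ q)) refl (x i) (A i j) (x j) ⟩
    A i j * (x i * x j)   ≤⟨ ℚₚ.*-monoˡ-≤-nonNeg (A i j) {{nonNegative (0≤A i j)}} (product≤norm² x i j) ⟩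
    A i j * N ∎

-- Sequences and reals

p≤∣p∣ : ∀ p → p ≤ ℚ.∣ p ∣
p≤∣p∣ p with ℚₚ.≤-total 0ℚ p
... | inj₁ 0≤p = ℚₚ.≤-reflexive (sym (ℚₚ.0≤p⇒∣p∣≡p 0≤p))
... | inj₂ p≤0 = ℚₚ.≤-trans p≤0 (ℚₚ.0≤∣p∣ p)

-p≤∣p∣ : ∀ p → - p ≤ ℚ.∣ p ∣
-p≤∣p∣ p = subst (- p ≤_) (ℚₚ.∣-p∣≡∣p∣ p) (p≤∣p∣ (- p))

∣p∣<q : ∀ {p q} → p < q → - p < q → ℚ.∣ p ∣ < q
∣p∣<q {p} {q} p<q -p<q with ℚₚ.∣p∣≡p∨∣p∣≡-p p
... | inj₁ eq = subst (_< q) (sym eq) p<q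
... | inj₂ eq = subst (_< q) (sym eq) -p<q

p²<q²⇒∣p∣<q : ∀ {p q} → 0ℚ ≤ q → p * p < q * q → ℚ.∣ p ∣ < q
p²<q²⇒∣p∣<q {p} {q} 0≤q p²<q² = ℚₚ.≰⇒> λ q≤∣p∣ → ℚₚ.<-irrefl refl (begin-strict
  p * p                <⟨ p²<q² ⟩
  q * q                ≤⟨ ℚₚ.*-monoˡ-≤-nonNeg q {{nonNegative 0≤q}} q≤∣p∣ ⟩
  q * ℚ.∣ p ∣          ≤⟨ ℚₚ.*-monoʳ-≤-nonNeg ℚ.∣ p ∣ {{nonNegative (ℚₚ.0≤∣p∣ p)}} q≤∣p∣ ⟩
  ℚ.∣ p ∣ * ℚ.∣ p ∣    ≡⟨ ℚₚ.∣p*q∣≡∣p∣*∣q∣ p p ⟨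
  ℚ.∣ p * p ∣          ≡⟨ ℚₚ.0≤p⇒∣p∣≡p (0≤p² p) ⟩
  p * p ∎)
  where open ℚₚ.≤-Reasoning

0<½* : ∀ {ε} → 0ℚ < ε → 0ℚ < ½ * ε
0<½* = 0<* (ℚₚ.positive⁻¹ ½)

½+½ : ∀ ε → ½ * ε + ½ * ε ≡ ε
½+½ = solve 1 (λ ε → con ½ ⊗ ε ⊕ con ½ ⊗ ε := ε) refl

p<q+r⇒p-r<q : ∀ {p q r} → p < q + r → p - r < q
p<q+r⇒p-r<q {p} {q} {r} p<q+r = subst (p - r <_)
  (solve 2 (λ q r → q ⊕ r ⊖ r := q) refl q r) (ℚₚ.+-monoˡ-< (- r) p<q+r)

-- Convergence gives eventual statements, whereas bisection gives semidefiniteness and failure of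
-- definiteness only infinitely often, possibly at different indices.
Eventually Frequently : (ℕ → Set) → Set
Eventually P = ∃[ N ] (∀ n → N ℕ.≤ n → P n)
Frequently P = ∀ N → ∃[ n ] (N ℕ.≤ n × P n)

frequently-eventually : ∀ {P Q R : ℕ → Set} → (∀ n → P n → Q n → R n) →
  Frequently P → Eventually Q → Frequently R
frequently-eventually f P-freq (N , Q-ev) K =
  let n , N⊔K≤n , p = P-freq (N ℕ.⊔ K)
  in n , ℕₚ.m⊔n≤o⇒n≤o N K N⊔K≤n , f n p (Q-ev n (ℕₚ.m⊔n≤o⇒m≤o N K N⊔K≤n))

eventually-map : ∀ {P Q : ℕ → Set} → (∀ n → P n → Q n) → Eventually P → Eventually Q
eventually-map f (N , P-ev) = N , λ n N≤n → f n (P-ev n N≤n)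

Null : (ℕ → ℚ) → Set
Null x = ∀ ε → 0ℚ < ε → Eventually (λ n → ℚ.∣ x n ∣ < ε)

Null-cong : ∀ {x y} → (∀ n → x n ≡ y n) → Null x → Null y
Null-cong x≗y x-null ε 0<ε = eventually-map (λ n → subst (λ q → ℚ.∣ q ∣ < ε) (x≗y n)) (x-null ε 0<ε)

≃0⇒Null : ∀ x → x ≃ℝ 0ℝ → Null (seq x)
≃0⇒Null x = Null-cong (λ n → ℚₚ.+-identityʳ (seq x n))

Null⇒≃0 : ∀ x → Null (seq x) → x ≃ℝ 0ℝ
Null⇒≃0 x = Null-cong (λ n → sym (ℚₚ.+-identityʳ (seq x n)))

-- Strict positivity as a rational gap `η`, so that it can be divided by.
Positiveℝ : ℝ → Set
Positiveℝ a = ∃[ η ] (0ℚ < η × Eventually (λ n → η < seq a n))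

close : ∀ a ε → 0ℚ < ε → ∃[ N ] (∀ m n → N ℕ.≤ m → N ℕ.≤ n → seq a m < seq a n + ε)
close a ε 0<ε =
  let N , h = cauchy a ε 0<ε
  in N , λ m n N≤m N≤n → subst (_< seq a n + ε)
       (solve 2 (λ p q → q ⊕ (p ⊖ q) := p) refl (seq a m) (seq a n))
       (ℚₚ.+-monoʳ-< (seq a n) (ℚₚ.≤-<-trans (p≤∣p∣ (seq a m - seq a n)) (h m n N≤m N≤n)))

-- Past the Cauchy index for `½ * ε`, a single rational comparison decides: either that term is at
-- most `½ * ε` and all later terms stay below `ε`, or it yields a positive gap. Hence a modulus is
-- obtained from a mere negation.
¬positive⇒≤0 : ∀ a → ¬ Positiveℝ a → ∀ ε → 0ℚ < ε → Eventually (λ n → seq a n < ε)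
¬positive⇒≤0 a ¬pos ε 0<ε =
  let N , h = close a (½ * ε) (0<½* 0<ε) in N , below N h (seq a N ℚₚ.≤? ½ * ε)
  where
  below : ∀ N → (∀ m n → N ℕ.≤ m → N ℕ.≤ n → seq a m < seq a n + ½ * ε) →
    Dec (seq a N ≤ ½ * ε) → ∀ n → N ℕ.≤ n → seq a n < ε
  below N h (yes aN≤) n N≤n = ℚₚ.<-≤-trans (h n N N≤n ℕₚ.≤-refl)
    (ℚₚ.≤-trans (ℚₚ.+-monoˡ-≤ (½ * ε) aN≤) (ℚₚ.≤-reflexive (½+½ ε)))
  below N h (no aN≰) _ _ = ⊥-elim (¬pos (seq a N - ½ * ε , p<q⇒0<q-p (ℚₚ.≰⇒> aN≰) ,
    N , λ n N≤n → p<q+r⇒p-r<q (h N n ℕₚ.≤-refl N≤n)))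

-- One small term past the Cauchy index controls all the terms after that index.
frequently-small⇒Null : ∀ a → (∀ ε → 0ℚ < ε → Frequently (λ n → ℚ.∣ seq a n ∣ < ε)) → Null (seq a)
frequently-small⇒Null a small ε 0<ε =
  let N , h = close a (½ * ε) (0<½* 0<ε)
      n , N≤n , an<ε = small (½ * ε) (0<½* 0<ε) N
      an  = seq a n
  in N , λ m N≤m → ∣p∣<q
       (begin-strict
         seq a m        <⟨ h m n N≤m N≤n ⟩
         an + ½ * ε     <⟨ ℚₚ.+-monoˡ-< (½ * ε) (ℚₚ.≤-<-trans (p≤∣p∣ an) an<ε) ⟩
         ½ * ε + ½ * ε  ≡⟨ ½+½ ε ⟩
         ε ∎)
       (begin-strict
         - seq a m                ≡⟨ solve 2 (λ m e → ⊝ m := ⊝ (m ⊕ e) ⊕ e) refl (seq a m) (½ * ε) ⟩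
         - (seq a m + ½ * ε) + ½ * ε  <⟨ ℚₚ.+-monoˡ-< (½ * ε) (ℚₚ.neg-antimono-< (h n m N≤n N≤m)) ⟩
         - an + ½ * ε             <⟨ ℚₚ.+-monoˡ-< (½ * ε) (ℚₚ.≤-<-trans (-p≤∣p∣ an) an<ε) ⟩
         ½ * ε + ½ * ε            ≡⟨ ½+½ ε ⟩
         ε ∎)
  where open ℚₚ.≤-Reasoning

¬positive∧frequently≥0⇒Null : ∀ a → ¬ Positiveℝ a → Frequently (λ n → 0ℚ ≤ seq a n) → Null (seq a)
¬positive∧frequently≥0⇒Null a ¬pos a≥0 = frequently-small⇒Null a λ ε 0<ε →
  frequently-eventually (λ n 0≤an an<ε → subst (_< ε) (sym (ℚₚ.0≤p⇒∣p∣≡p 0≤an)) an<ε)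
    a≥0 (¬positive⇒≤0 a ¬pos ε 0<ε)

positive*null⇒null : ∀ a x → Positiveℝ a → Null (λ n → seq a n * seq x n) → Null (seq x)
positive*null⇒null a x (η , 0<η , M , η<a) ax-null ε 0<ε =
  let N , h = ax-null (η * ε) (0<* 0<η 0<ε)
  in M ℕ.⊔ N , λ n M⊔N≤n →
    let ∣x∣ = ℚ.∣ seq x n ∣
        an = seq a n
    in ℚₚ.*-cancelˡ-<-nonNeg η {{nonNegative (ℚₚ.<⇒≤ 0<η)}} (begin-strict
      η * ∣x∣            ≤⟨ ℚₚ.*-monoʳ-≤-nonNeg ∣x∣ {{nonNegative (ℚₚ.0≤∣p∣ (seq x n))}}
                             (ℚₚ.<⇒≤ (ℚₚ.<-≤-trans (η<a n (ℕₚ.m⊔n≤o⇒m≤o M N M⊔N≤n)) (p≤∣p∣ an))) ⟩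
      ℚ.∣ an ∣ * ∣x∣     ≡⟨ ℚₚ.∣p*q∣≡∣p∣*∣q∣ an (seq x n) ⟨
      ℚ.∣ an * seq x n ∣ <⟨ h n (ℕₚ.m⊔n≤o⇒n≤o M N M⊔N≤n) ⟩
      η * ε ∎)
  where open ℚₚ.≤-Reasoning

-- The order amounts to the negation of positivity of `x -ℝ y`, and negations are stable.
≤ℝ-stable : ∀ x y → ¬ ¬ (x ≤ℝ y) → x ≤ℝ y
≤ℝ-stable x y ¬¬x≤y ε 0<ε = eventually-map
  (λ n d<ε → subst (_< seq y n + ε)
    (solve 2 (λ p q → q ⊕ (p ⊖ q) := p) refl (seq x n) (seq y n)) (ℚₚ.+-monoʳ-< (seq y n) d<ε))
  (¬positive⇒≤0 (x -ℝ y) ¬pos ε 0<ε)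
  where
  ¬pos : ¬ Positiveℝ (x -ℝ y)
  ¬pos (η , 0<η , N , η<d) = ¬¬x≤y λ x≤y →
    let M , h = x≤y η 0<η
        n  = M ℕ.⊔ N
    in ℚₚ.<-asym (η<d n (ℕₚ.m≤n⊔m M N)) (p<q+r⇒p-r<q
         (subst (seq x n <_) (ℚₚ.+-comm (seq y n) η) (h n (ℕₚ.m≤m⊔n M N))))

-- Archimedean bounds and bisection

fromℕ-suc : ∀ k → ℤ.+ suc k / 1 ≡ 1ℚ + ℤ.+ k / 1
fromℕ-suc k = sym (trans (cong (1ℚ +_) (ℚₚ.normalize-coprime coprime))
  (cong (λ i → (ℤ.+ 1 ℤ.+ i) / 1) (ℤₚ.*-identityʳ (ℤ.+ k))))
  where
  coprime : Coprimality.Coprime k 1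
  coprime = Coprimality.sym (Coprimality.1-coprimeTo k)

0≤fromℕ : ∀ k → 0ℚ ≤ ℤ.+ k / 1
0≤fromℕ k = ℚₚ.nonNegative⁻¹ (ℤ.+ k / 1) {{ℚₚ.normalize-nonNeg k 1}}

-- The Archimedean property with an explicit witness: the denominator is at least 1, so the absolute
-- value of the numerator suffices.
≤fromℕ∣↥∣ : ∀ q → q ≤ ℤ.+ ℤ.∣ ↥ q ∣ / 1
≤fromℕ∣↥∣ q@(mkℚ i d-1 _) = subst (q ≤_) (sym (ℚₚ.normalize-coprime coprime)) (ℚ.*≤* (begin
  i ℤ.* ℤ.+ 1                ≡⟨ ℤₚ.*-identityʳ i ⟩
  i                          ≤⟨ i≤∣i∣ i ⟩
  ℤ.+ ℤ.∣ i ∣                ≤⟨ ℤ.+≤+ (ℕₚ.m≤m*n ℤ.∣ i ∣ (suc d-1)) ⟩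
  ℤ.+ (ℤ.∣ i ∣ ℕ.* suc d-1)  ≡⟨ ℤₚ.pos-* ℤ.∣ i ∣ (suc d-1) ⟩
  ℤ.+ ℤ.∣ i ∣ ℤ.* ℤ.+ suc d-1 ∎))
  where
  open ℤₚ.≤-Reasoning
  coprime : Coprimality.Coprime ℤ.∣ i ∣ 1
  coprime = Coprimality.sym (Coprimality.1-coprimeTo ℤ.∣ i ∣)

  i≤∣i∣ : ∀ i → i ℤ.≤ ℤ.+ ℤ.∣ i ∣
  i≤∣i∣ (ℤ.+ n)      = ℤₚ.≤-refl
  i≤∣i∣ (ℤ.-[1+ n ]) = ℤ.-≤+

2^_ : ℕ → ℚ
2^ zero  = 1ℚ
2^ suc n = 2^ n + 2^ n

1≤2^ : ∀ n → 1ℚ ≤ 2^ n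
1≤2^ zero    = ℚₚ.≤-refl
1≤2^ (suc n) = ℚₚ.≤-trans (1≤2^ n) (q≡p+d⇒p≤q refl (ℚₚ.≤-trans (ℚₚ.nonNegative⁻¹ 1ℚ) (1≤2^ n)))

fromℕ<2^ : ∀ n → ℤ.+ n / 1 < 2^ n
fromℕ<2^ zero    = ℚₚ.positive⁻¹ 1ℚ
fromℕ<2^ (suc n) = subst (_< 2^ suc n) (sym (fromℕ-suc n)) (ℚₚ.+-mono-≤-< (1≤2^ n) (fromℕ<2^ n))

-- The invariant is that `Lo` holds at the left end and `Hi` at the right end of every interval;
-- `decide` at the midpoint selects a half that keeps it.
module Bisection (Lo Hi : ℚ → Set) (decide : ∀ q → Lo q ⊎ Hi q)
  (lo₀ w₀ : ℚ) (0≤w₀ : 0ℚ ≤ w₀) (Lo-lo₀ : Lo lo₀) (Hi-hi₀ : Hi (lo₀ + w₀)) where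

  width : ℕ → ℚ
  width zero    = w₀
  width (suc n) = ½ * width n

  -- Here `w` is the width after halving, so `l + w` is the midpoint.
  next : ℚ → ℚ → ℚ
  next l w = [ const (l + w) , const l ]′ (decide (l + w))

  lower : ℕ → ℚ
  lower zero    = lo₀
  lower (suc n) = next (lower n) (width (suc n))

  upper : ℕ → ℚ
  upper n = lower n + width n

  0≤width : ∀ n → 0ℚ ≤ width n
  0≤width zero    = 0≤w₀
  0≤width (suc n) = 0≤* (ℚₚ.nonNegative⁻¹ ½) (0≤width n)

  next-spec : ∀ l w → 0ℚ ≤ w → Lo l → Hi (l + (w + w)) →
    (Lo (next l w) × Hi (next l w + w)) × (l ≤ next l w × next l w + w ≤ l + (w + w))
  next-spec l w 0≤w Lo-l Hi-u with decide (l + w)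
  ... | inj₁ Lo-m = (Lo-m , subst Hi (sym (ℚₚ.+-assoc l w w)) Hi-u)
                  , (q≡p+d⇒p≤q refl 0≤w , ℚₚ.≤-reflexive (ℚₚ.+-assoc l w w))
  ... | inj₂ Hi-m = (Lo-l , Hi-m)
                  , (ℚₚ.≤-refl , q≡p+d⇒p≤q (sym (ℚₚ.+-assoc l w w)) 0≤w)

  bounds : ∀ n → Lo (lower n) × Hi (upper n)
  step   : ∀ n → (Lo (lower (suc n)) × Hi (upper (suc n))) ×
                 (lower n ≤ lower (suc n) × upper (suc n) ≤ lower n + (width (suc n) + width (suc n)))
  bounds zero    = Lo-lo₀ , Hi-hi₀
  bounds (suc n) = proj₁ (step n)
  step n = next-spec (lower n) (width (suc n)) (0≤width (suc n)) (proj₁ (bounds n))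
    (subst (λ w → Hi (lower n + w)) (sym (½+½ (width n))) (proj₂ (bounds n)))

  lower-mono : ∀ {m n} → m ℕ.≤′ n → lower m ≤ lower n
  lower-mono (ℕ.≤′-reflexive refl) = ℚₚ.≤-refl
  lower-mono {n = suc n} (ℕ.≤′-step m≤n) = ℚₚ.≤-trans (lower-mono m≤n) (proj₁ (proj₂ (step n)))

  upper-anti : ∀ {m n} → m ℕ.≤′ n → upper n ≤ upper m
  upper-anti (ℕ.≤′-reflexive refl)     = ℚₚ.≤-refl
  upper-anti {n = suc n} (ℕ.≤′-step m≤n) = ℚₚ.≤-trans
    (subst (λ w → upper (suc n) ≤ lower n + w) (½+½ (width n)) (proj₂ (proj₂ (step n))))
    (upper-anti m≤n)

  width*2^ : ∀ n → width n * 2^ n ≡ w₀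
  width*2^ zero    = ℚₚ.*-identityʳ w₀
  width*2^ (suc n) = trans (solve 2 (λ w p → (con ½ ⊗ w) ⊗ (p ⊕ p) := w ⊗ p) refl (width n) (2^ n)) (width*2^ n)

  width-small : ∀ ε → 0ℚ < ε → ∃[ N ] width N < ε
  width-small ε 0<ε = N , ℚₚ.*-cancelʳ-<-nonNeg (2^ N) {{nonNegative (ℚₚ.≤-trans (ℚₚ.nonNegative⁻¹ 1ℚ) (1≤2^ N))}}
    (begin-strict
      width N * 2^ N   ≡⟨ width*2^ N ⟩
      w₀               ≡⟨ ℚₚ.*-identityˡ w₀ ⟨
      1ℚ * w₀          ≡⟨ cong (_* w₀) (*-recip 0<ε) ⟨
      ε * r * w₀       ≡⟨ ℚₚ.*-assoc ε r w₀ ⟩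
      ε * (r * w₀)     <⟨ ℚₚ.*-monoʳ-<-pos ε {{positive 0<ε}} (ℚₚ.≤-<-trans (≤fromℕ∣↥∣ (r * w₀)) (fromℕ<2^ N)) ⟩
      ε * 2^ N ∎)
    where
    open ℚₚ.≤-Reasoning
    r = recip 0<ε
    -- This `N` is at least `w₀ / ε`, and `2^ N` exceeds `N`, so `N` halvings are enough.
    N = ℤ.∣ ↥ (r * w₀) ∣

  even : ℕ → Bool
  even zero    = true
  even (suc n) = not (even n)

  -- Alternating between the two endpoints, so that both properties hold infinitely often.
  endpoint : ℕ → ℚ
  endpoint n = if even n then lower n else upper n

  endpoint-between : ∀ n → lower n ≤ endpoint n × endpoint n ≤ upper n
  endpoint-between n with even n
  ... | true  = ℚₚ.≤-refl , q≡p+d⇒p≤q refl (0≤width n)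
  ... | false = q≡p+d⇒p≤q refl (0≤width n) , ℚₚ.≤-refl

  -- The intervals are nested, so from `N` on all chosen endpoints lie in the `N`-th interval,
  -- whichever side each is taken from.
  endpoint-cauchy : Cauchy endpoint
  endpoint-cauchy ε 0<ε =
    let N , w<ε = width-small ε 0<ε
        lo≤ : ∀ {n} → N ℕ.≤ n → lower N ≤ endpoint n
        lo≤ {n} N≤n = ℚₚ.≤-trans (lower-mono (ℕₚ.≤⇒≤′ N≤n)) (proj₁ (endpoint-between n))
        ≤hi : ∀ {n} → N ℕ.≤ n → endpoint n ≤ upper N
        ≤hi {n} N≤n = ℚₚ.≤-trans (proj₂ (endpoint-between n)) (upper-anti (ℕₚ.≤⇒≤′ N≤n))
        diff : ∀ {m n} → N ℕ.≤ m → N ℕ.≤ n → endpoint m - endpoint n < ε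
        diff {m} {n} N≤m N≤n = ℚₚ.≤-<-trans (ℚₚ.+-mono-≤ (≤hi N≤m) (ℚₚ.neg-antimono-≤ (lo≤ N≤n)))
          (subst (_< ε) (solve 2 (λ l w → w := l ⊕ w ⊖ l) refl (lower N) (width N)) w<ε)
    in N , λ m n N≤m N≤n → ∣p∣<q (diff N≤m N≤n)
         (subst (_< ε) (solve 2 (λ p q → q ⊖ p := ⊝ (p ⊖ q)) refl (endpoint m) (endpoint n)) (diff N≤n N≤m))

  limit : ℝ
  limit = mkℝ endpoint endpoint-cauchy

  lo₀≤limit : ∀ n → lo₀ ≤ seq limit n
  lo₀≤limit n = ℚₚ.≤-trans (lower-mono {0} {n} (ℕₚ.≤⇒≤′ ℕ.z≤n)) (proj₁ (endpoint-between n))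

  frequently-Lo : Frequently (λ n → Lo (seq limit n))
  frequently-Lo N with even N in eq
  ... | true  = N , ℕₚ.≤-refl , subst (λ b → Lo (if b then lower N else upper N)) (sym eq) (proj₁ (bounds N))
  ... | false = suc N , ℕₚ.n≤1+n N ,
    subst (λ b → Lo (if not b then lower (suc N) else upper (suc N))) (sym eq) (proj₁ (bounds (suc N)))

  frequently-Hi : Frequently (λ n → Hi (seq limit n))
  frequently-Hi N with even N in eq
  ... | false = N , ℕₚ.≤-refl , subst (λ b → Hi (if b then lower N else upper N)) (sym eq) (proj₂ (bounds N))
  ... | true  = suc N , ℕₚ.n≤1+n N ,
    subst (λ b → Hi (if not b then lower (suc N) else upper (suc N))) (sym eq) (proj₂ (bounds (suc N)))

-- Eigenvalues of a symmetric matrix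

-- Real arithmetic acts termwise on representatives, so a real matrix is a sequence of rational
-- matrices and the identities over ℚ hold exactly at each index.
at : ∀ {k} → Matrix k → ℕ → Matrixℚ k
at M n i j = seq (M i j) n

atᵥ : ∀ {k} → Vector ℝ k → ℕ → Vector ℚ k
atᵥ x n i = seq (x i) n

seq-sumℝ : ∀ {k} (f : Vector ℝ k) n → seq (sumℝ f) n ≡ sum (λ i → seq (f i) n)
seq-sumℝ {zero}  f n = refl
seq-sumℝ {suc k} f n = cong (seq (f zero) n +_) (seq-sumℝ (f ∘ suc) n)

schurℝ : ∀ {k} → Matrix (suc k) → Matrix k
schurℝ M i j = M zero zero *ℝ M (suc i) (suc j) -ℝ M (suc i) zero *ℝ M zero (suc j)

HasKernel : ∀ {k} → Matrix k → Set
HasKernel {k} M = Σ (Vector ℝ k) λ x →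
  (¬ (∀ i → Null (seq (x i)))) × (∀ i → Null (λ n → mulVec (at M n) (atᵥ x n) i))

-- Back substitution with the division cleared: a kernel vector `y` of the Schur complement lifts to
-- `- β` followed by `a` times `y`. Row 0 then cancels identically and the other rows are those of
-- the Schur complement. Positivity of `a` keeps the lift nonzero.
schur-kernel : ∀ {k} (M : Matrix (suc k)) → Positiveℝ (M zero zero) → HasKernel (schurℝ M) → HasKernel M
schur-kernel {k} M a>0 (y , y≢0 , Sy≡0) = x , x≢0 , Mx≡0
  where
  a : ℝ
  a = M zero zero

  β : ℝ
  β = sumℝ (λ j → M zero (suc j) *ℝ y j)

  x : Vector ℝ (suc k)
  x zero    = -ℝ β
  x (suc j) = a *ℝ y j

  x≢0 : ¬ (∀ i → Null (seq (x i)))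
  x≢0 x≡0 = y≢0 λ i → positive*null⇒null a (y i) a>0 (x≡0 (suc i))

  scale-row : ∀ n i → sum (λ j → seq (M i (suc j)) n * (seq a n * seq (y j) n)) ≡
    seq a n * sum (λ j → seq (M i (suc j)) n * seq (y j) n)
  scale-row n i = trans
    (sum-cong-≗ (λ j → solve 3 (λ m a y → m ⊗ (a ⊗ y) := a ⊗ (m ⊗ y))
      refl (seq (M i (suc j)) n) (seq a n) (seq (y j) n)))
    (sym (*-distribˡ-sum (seq a n) (λ j → seq (M i (suc j)) n * seq (y j) n)))

  row-value : ∀ n i → mulVec (at M n) (atᵥ x n) i ≡
    seq a n * sum (λ j → seq (M i (suc j)) n * seq (y j) n) - seq (M i zero) n * row₀ (at M n) (atᵥ y n)
  row-value n i = trans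
    (cong₂ (λ u v → seq (M i zero) n * (- u) + v)
      (seq-sumℝ (λ j → M zero (suc j) *ℝ y j) n) (scale-row n i))
    (solve 3 (λ c β q → c ⊗ (⊝ β) ⊕ q := q ⊖ c ⊗ β) refl
      (seq (M i zero) n) (row₀ (at M n) (atᵥ y n))
      (seq a n * sum (λ j → seq (M i (suc j)) n * seq (y j) n)))

  Mx≡0 : ∀ i → Null (λ n → mulVec (at M n) (atᵥ x n) i)
  Mx≡0 zero    ε 0<ε = 0 , λ n _ → subst (λ q → ℚ.∣ q ∣ < ε)
    (sym (trans (row-value n zero) (ℚₚ.+-inverseʳ (seq a n * row₀ (at M n) (atᵥ y n))))) 0<ε
  Mx≡0 (suc i) = Null-cong
    (λ n → trans (mulVec-schur (at M n) (atᵥ y n) i) (sym (row-value n (suc i)))) (Sy≡0 i)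

-- The bound k b² ≤ c holds as soon as a k ≤ 1. As the pivot `a` tends to 0, `k` may be taken
-- arbitrarily large while the diagonal entry `c` stays bounded, which forces `b` to 0.
row-null : ∀ {k} (M : Matrix (suc k)) → (∀ n → Symmetric (at M n)) →
  Frequently (λ n → PSD (at M n)) → Null (seq (M zero zero)) → ∀ j → Null (seq (M zero (suc j)))
row-null M M-sym psd a-null j = frequently-small⇒Null b small
  where
  b c : ℝ
  b = M zero (suc j)
  c = M (suc j) (suc j)

  small : ∀ ε → 0ℚ < ε → Frequently (λ n → ℚ.∣ seq b n ∣ < ε)
  small ε 0<ε =
    let N , h = close c 1ℚ (ℚₚ.positive⁻¹ 1ℚ)
        B = ℚ.∣ seq c N ∣ + 1ℚ
        0<B = ℚₚ.+-mono-≤-< (ℚₚ.0≤∣p∣ (seq c N)) (ℚₚ.positive⁻¹ 1ℚ)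
        c<B = λ n N≤n → ℚₚ.<-≤-trans (h n N N≤n ℕₚ.≤-refl) (ℚₚ.+-monoˡ-≤ 1ℚ (p≤∣p∣ (seq c N)))
    in bounded B 0<B (N , c<B)
    where
    0<ε² = 0<* 0<ε 0<ε

    bounded : ∀ B → 0ℚ < B → Eventually (λ n → seq c n < B) → Frequently (λ n → ℚ.∣ seq b n ∣ < ε)
    bounded B 0<B c<B = frequently-eventually final
      (frequently-eventually row-bound psd (a-null (recip 0<k) (0<recip 0<k))) c<B
      where
      -- Chosen so that k ε² = B: then k b² ≤ c < B gives b² < ε².
      k = B * recip 0<ε²
      0<k : 0ℚ < k
      0<k = 0<* 0<B (0<recip 0<ε²)

      row-bound : ∀ n → PSD (at M n) → ℚ.∣ seq (M zero zero) n ∣ < recip 0<k →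
        k * (seq b n * seq b n) ≤ seq c n
      row-bound n M≥0 a<1/k = PSD⇒row-bound (M-sym n) M≥0 j k (ℚₚ.<⇒≤ 0<k) (begin
        seq (M zero zero) n * k   ≤⟨ ℚₚ.*-monoʳ-≤-nonNeg k {{nonNegative (ℚₚ.<⇒≤ 0<k)}}
                                       (ℚₚ.≤-trans (p≤∣p∣ (seq (M zero zero) n)) (ℚₚ.<⇒≤ a<1/k)) ⟩
        recip 0<k * k             ≡⟨ ℚₚ.*-comm (recip 0<k) k ⟩
        k * recip 0<k             ≡⟨ *-recip 0<k ⟩
        1ℚ ∎)
        where open ℚₚ.≤-Reasoning

      final : ∀ n → k * (seq b n * seq b n) ≤ seq c n → seq c n < B → ℚ.∣ seq b n ∣ < ε
      final n kb²≤c c<B = p²<q²⇒∣p∣<q (ℚₚ.<⇒≤ 0<ε)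
        (ℚₚ.*-cancelˡ-<-nonNeg k {{nonNegative (ℚₚ.<⇒≤ 0<k)}} (begin-strict
          k * (seq b n * seq b n)               ≤⟨ kb²≤c ⟩
          seq c n                               <⟨ c<B ⟩
          B                                     ≡⟨ ℚₚ.*-identityʳ B ⟨
          B * 1ℚ                                ≡⟨ cong (B *_) (*-recip 0<ε²) ⟨
          B * ((ε * ε) * recip 0<ε²)
            ≡⟨ solve 3 (λ B e r → B ⊗ (e ⊗ r) := B ⊗ r ⊗ e) refl B (ε * ε) (recip 0<ε²) ⟩
          k * (ε * ε) ∎))
        where open ℚₚ.≤-Reasoning

zero-pivot-kernel : ∀ {k} (M : Matrix (suc k)) → (∀ i → Null (seq (M i zero))) → HasKernel M
zero-pivot-kernel {k} M col-null = e₀ , e₀≢0 , λ i → Null-cong (λ n → sym (Me₀ n i)) (col-null i)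
  where
  e₀ : Vector ℝ (suc k)
  e₀ zero    = 1ℝ
  e₀ (suc _) = 0ℝ

  e₀≢0 : ¬ (∀ i → Null (seq (e₀ i)))
  e₀≢0 e₀≡0 = let N , h = e₀≡0 zero 1ℚ (ℚₚ.positive⁻¹ 1ℚ) in ℚₚ.<-irrefl refl (h N ℕₚ.≤-refl)

  Me₀ : ∀ n i → mulVec (at M n) (atᵥ e₀ n) i ≡ seq (M i zero) n
  Me₀ n i = trans (cong₂ _+_ (ℚₚ.*-identityʳ (seq (M i zero) n))
    (trans (sum-cong-≗ (λ j → ℚₚ.*-comm (seq (M i (suc j)) n) 0ℚ)) (sum-0* (λ j → seq (M i (suc j)) n))))
    (ℚₚ.+-identityʳ (seq (M i zero) n))

-- Induction on the size. Because the conclusion is a double negation, the absence of a kernel may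
-- be assumed; it refutes positivity of the pivot through the Schur complement, and the pivot, being
-- infinitely often nonnegative, is then null.
semidefinite-singular⇒kernel : ∀ {k} (M : Matrix k) → (∀ n → Symmetric (at M n)) →
  Frequently (λ n → PSD (at M n)) → Frequently (λ n → ¬ PositivePivots (at M n)) → ¬ ¬ HasKernel M
-- The empty matrix has positive pivots trivially, so `sing` is contradictory.
semidefinite-singular⇒kernel {zero}  M M-sym psd sing _ = proj₂ (proj₂ (sing 0)) tt
semidefinite-singular⇒kernel {suc k} M M-sym psd sing ¬ker = ¬ker (zero-pivot-kernel M col-null)
  where
  a : ℝ
  a = M zero zero

  ¬a>0 : ¬ Positiveℝ a
  ¬a>0 a>0@(η , 0<η , η<a) = semidefinite-singular⇒kernel (schurℝ M) (λ n → schur-sym (M-sym n))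
    (frequently-eventually (λ n M≥0 η<an → schur-PSD (M-sym n) (ℚₚ.<-trans 0<η η<an) M≥0) psd η<a)
    -- With the first pivot positive, a failure of `PositivePivots` must occur in the Schur
    -- complement.
    (frequently-eventually (λ n ¬pp η<an pp → ¬pp (ℚₚ.<-trans 0<η η<an , pp)) sing η<a)
    (λ ker → ¬ker (schur-kernel M a>0 ker))

  a-null : Null (seq a)
  a-null = ¬positive∧frequently≥0⇒Null a ¬a>0
    λ N → let n , N≤n , M≥0 = psd N in n , N≤n , PSD⇒0≤pivot (M-sym n) M≥0

  col-null : ∀ i → Null (seq (M i zero))
  col-null zero    = a-null
  col-null (suc i) = Null-cong (λ n → M-sym n zero (suc i)) (row-null M M-sym psd a-null i)

eigenvalue-above : ∀ {k} (A : Matrixℚ k) → Symmetric A → (∀ i j → 0ℚ ≤ A i j) →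
  ∀ t → 0ℚ ≤ t → ¬ PositivePivots (shift A t) →
  ∃[ ν ] ((∀ n → t ≤ seq ν n) × ¬ ¬ IsEigenvalue (λ i j → fromℚ (A i j)) ν)
eigenvalue-above {k} A A-sym 0≤A t 0≤t sing = limit , lo₀≤limit ,
  λ ¬eig → semidefinite-singular⇒kernel M (λ n → shift-sym A-sym (seq limit n)) frequently-Hi frequently-Lo
    λ (x , x≢0 , Mx≡0) → ¬eig
      (x , (λ x≃0 → x≢0 (λ i → ≃0⇒Null (x i) (x≃0 i))) , λ i → Null-cong (eq x i) (Null-neg (Mx≡0 i)))
  where
  0≤w : 0ℚ ≤ total A
  0≤w = 0≤sum (λ i → 0≤sum (0≤A i))

  -- Semidefiniteness itself quantifies over all vectors; the decidable pivots stand in for it.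
  decide : ∀ q → (¬ PositivePivots (shift A q)) ⊎ PSD (shift A q)
  decide q with positivePivots? (shift A q)
  ... | yes pp = inj₂ (positivePivots⇒PSD (shift-sym A-sym q) pp)
  ... | no ¬pp = inj₁ ¬pp

  -- The left end `t` fails by hypothesis; at `t + total A` the crude spectral bound applies because
  -- `t` is nonnegative.
  open Bisection (λ q → ¬ PositivePivots (shift A q)) (λ q → PSD (shift A q)) decide
    t (total A) 0≤w sing (shift-PSD 0≤A (q≡p+d⇒p≤q (ℚₚ.+-comm t (total A)) 0≤t))

  -- At index `n` this is definitionally `shift A (seq limit n)`, so what bisection provides applies
  -- directly.
  M : Matrix k
  M i j = limit *ℝ fromℚ (δ i j) -ℝ fromℚ (A i j)

  Null-neg : ∀ {x} → Null x → Null (λ n → - x n)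
  Null-neg {x} x-null ε 0<ε = eventually-map (λ n → subst (_< ε) (sym (ℚₚ.∣-p∣≡∣p∣ (x n)))) (x-null ε 0<ε)

  eq : ∀ x i n → - mulVec (at M n) (atᵥ x n) i ≡
    seq (((λ i j → fromℚ (A i j)) ·ᵥ x) i) n - seq (limit *ℝ x i) n
  eq x i n = trans (cong -_ (mulVec-shift A (seq limit n) (atᵥ x n) i))
    (trans (solve 2 (λ p q → ⊝ (p ⊖ q) := q ⊖ p) refl (seq limit n * seq (x i) n) (mulVec A (atᵥ x n) i))
      (cong (_- seq limit n * seq (x i) n) (sym (seq-sumℝ (λ j → fromℚ (A i j) *ℝ x j) n))))

-- Greedy colouring and the adjacency matrix

-- If all `k` elements occurred in the shorter list, two of them would share a position, and the
-- position determines the element.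
fresh : ∀ {k} (xs : List (Fin k)) → length xs ℕ.< k → ∃[ x ] x ∉ₗ xs
fresh {k} xs xs<k = Finₚ.¬∀⟶∃¬ k (_∈ₗ xs) (λ x → anyₗ? (x Fin.≟_) xs) λ ∈xs →
  let i , j , i<j , eq = Finₚ.pigeonhole xs<k (index ∘ ∈xs)
  in Finₚ.<⇒≢ i<j (trans (lookup-index (∈xs i))
       (trans (cong (lookup xs) eq) (sym (lookup-index (∈xs j)))))

module Greedy {n} (Adj : Fin n → Fin n → Set) (adj? : ∀ i j → Dec (Adj i j))
  (Adj-irrefl : ∀ {i} → ¬ Adj i i) (Adj-sym : ∀ {i j} → Adj i j → Adj j i) where

  neighbour? : ∀ (T : Subset n) i j → Dec (j ∈ T × Adj i j)
  neighbour? T i j = (j ∈? T) ×-dec adj? i j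

  neighbours : Subset n → Fin n → List (Fin n)
  neighbours T i = filter (neighbour? T i) (allFin n)

  degree : Subset n → Fin n → ℕ
  degree T i = length (neighbours T i)

  -- A nonempty set inducing a subgraph of minimum degree at least `k`; the largest such set is the
  -- `k`-core of graph theory.
  Core : ℕ → Set
  Core k = ∃[ S ] (Nonempty S × (∀ i → i ∈ S → k ℕ.≤ degree S i))

  ColorableOn : ℕ → Subset n → Set
  ColorableOn k T = Σ (Fin n → Fin k) λ c → ∀ i j → i ∈ T → j ∈ T → Adj i j → c i ≢ c j

  -- The neighbours of `i` in `T` use fewer than `k` colours, so one remains for `i`; all other
  -- vertices keep theirs.
  extend : ∀ {k T i} → degree T i ℕ.< k → ColorableOn k (T ∖ i) → ColorableOn k T
  extend {k} {T} {i} deg<k (c , proper) = c′ , proper′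
    where
    free : ∃[ x ] x ∉ₗ map c (neighbours T i)
    free = fresh (map c (neighbours T i)) (subst (ℕ._< k) (sym (length-map c (neighbours T i))) deg<k)

    choose : ∀ {j} → Dec (j ≡ i) → Fin k
    choose     (yes _) = proj₁ free
    choose {j} (no _)  = c j

    c′ : Fin n → Fin k
    c′ j = choose (j Fin.≟ i)

    free≢ : ∀ {j} → j ∈ T → Adj i j → proj₁ free ≢ c j
    free≢ {j} j∈T ij eq = proj₂ free (subst (_∈ₗ map c (neighbours T i)) (sym eq)
      (∈-map⁺ c (∈-filter⁺ (neighbour? T i) (∈-allFin j) (j∈T , ij))))

    proper′ : ∀ j l → j ∈ T → l ∈ T → Adj j l → c′ j ≢ c′ l
    proper′ j l j∈T l∈T jl with j Fin.≟ i | l Fin.≟ i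
    ... | yes refl | yes refl = λ _ → Adj-irrefl jl
    ... | yes refl | no _     = free≢ l∈T jl
    ... | no _     | yes refl = free≢ j∈T (Adj-sym jl) ∘ sym
    ... | no j≢i   | no l≢i   = proper j l (x∈p∧x≢y⇒x∈p-y j∈T j≢i) (x∈p∧x≢y⇒x∈p-y l∈T l≢i) jl

  -- Vertices of degree at most `k` inside the remaining set are removed one by one and coloured on
  -- the way back. If the removal stops at a nonempty set, that set is a core. The bound `m` on the
  -- size of `T` makes the recursion structural.
  core-or-colorable-on : ∀ k m (T : Subset n) → ∣ T ∣ ℕ.≤ m → Core (suc k) ⊎ ColorableOn (suc k) T
  core-or-colorable-on k m T ∣T∣≤m with Finₚ.any? (λ i → (i ∈? T) ×-dec (degree T i ℕ.<? suc k))
  core-or-colorable-on k zero T ∣T∣≤m | yes (i , i∈T , _) =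
    ⊥-elim (ℕₚ.n≮0 (ℕₚ.<-≤-trans (x∈p⇒∣p-x∣<∣p∣ i∈T) ∣T∣≤m))
  core-or-colorable-on k (suc m) T ∣T∣≤m | yes (i , i∈T , deg<) =
    [ inj₁ , inj₂ ∘ extend deg< ]′
      (core-or-colorable-on k m (T ∖ i) (ℕₚ.≤-pred (ℕₚ.<-≤-trans (x∈p⇒∣p-x∣<∣p∣ i∈T) ∣T∣≤m)))
  ... | no all≥ with nonempty? T
  ...   | yes T≢∅ = inj₁ (T , T≢∅ , λ i i∈T → ℕₚ.≮⇒≥ λ deg< → all≥ (i , i∈T , deg<))
  ...   | no T≡∅  = inj₂ ((λ _ → zero) , λ i _ i∈T → ⊥-elim (T≡∅ (i , i∈T)))

  core-or-colorable : Fin n → ∀ k → Core k ⊎ ColorableOn k full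
  -- Without colours the whole vertex set serves as a core, nonempty because of `i`.
  core-or-colorable i zero    = inj₁ (full , (i , ∈⊤) , λ _ _ → ℕ.z≤n)
  core-or-colorable _ (suc k) = core-or-colorable-on k ∣ full {n} ∣ full ℕₚ.≤-refl

indicator : ∀ {P : Set} → Dec P → ℚ
indicator d = if does d then 1ℚ else 0ℚ

-- Stated for `tabulate f` so that the induction goes through; `allFin` is the case of the identity.
count≡sum : ∀ {A : Set} {P : A → Set} (P? : ∀ x → Dec (P x)) {n} (f : Fin n → A) →
  ℤ.+ length (filter P? (tabulate f)) / 1 ≡ sum (λ j → indicator (P? (f j)))
count≡sum P? {zero}  f = refl
count≡sum P? {suc n} f with P? (f zero)
... | yes _ = trans (fromℕ-suc (length (filter P? (tabulate (f ∘ suc))))) (cong (1ℚ +_) (count≡sum P? (f ∘ suc)))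
... | no _  = trans (count≡sum P? (f ∘ suc)) (sym (ℚₚ.+-identityˡ (sum (λ j → indicator (P? (f (suc j)))))))

fromℕ-mono : ∀ {m n} → m ℕ.≤ n → ℤ.+ m / 1 ≤ ℤ.+ n / 1
fromℕ-mono {n = n} ℕ.z≤n = 0≤fromℕ n
fromℕ-mono {suc m} {suc n} (ℕ.s≤s m≤n) = subst (_≤ ℤ.+ suc n / 1) (sym (fromℕ-suc m))
  (subst (1ℚ + ℤ.+ m / 1 ≤_) (sym (fromℕ-suc n)) (ℚₚ.+-monoʳ-≤ 1ℚ (fromℕ-mono m≤n)))

1/suc : ∀ k → ℤ.+ 1 / suc k ≡ mkℚ (ℤ.+ 1) k (Coprimality.1-coprimeTo (suc k))
1/suc k = ℚₚ.normalize-coprime (Coprimality.1-coprimeTo (suc k))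

0≤1/[-1] : ∀ k → 0ℚ ≤ 1/[ k -1]
0≤1/[-1] 0             = ℚₚ.≤-refl
0≤1/[-1] 1             = ℚₚ.≤-refl
0≤1/[-1] (suc (suc k)) = ℚₚ.nonNegative⁻¹ (ℤ.+ 1 / suc k) {{ℚₚ.normalize-nonNeg 1 (suc k)}}

-- The default value 0 below 2 would break monotonicity, hence the lower bound on `m`.
1/[-1]-anti : ∀ {m n} → 2 ℕ.≤ m → m ℕ.≤ n → 1/[ n -1] ≤ 1/[ m -1]
1/[-1]-anti {suc (suc a)} {suc (suc b)} _ (ℕ.s≤s 1+a≤1+b) =
  subst₂ _≤_ (sym (1/suc b)) (sym (1/suc a)) (ℚ.*≤* (ℤₚ.*-monoˡ-≤-nonNeg (ℤ.+ 1) (ℤ.+≤+ 1+a≤1+b)))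
1/[-1]-anti {suc zero} (ℕ.s≤s ()) _

fromℕ*1/suc : ∀ k → (ℤ.+ suc k / 1) * (ℤ.+ 1 / suc k) ≡ 1ℚ
fromℕ*1/suc k = trans
  (cong₂ _*_ (ℚₚ.normalize-coprime {suc k} {0} coprime) (1/suc k))
  (ℚₚ.*-inverseʳ (mkℚ (ℤ.+ suc k) 0 coprime))
  where
  coprime : Coprimality.Coprime (suc k) 1
  coprime = Coprimality.sym (Coprimality.1-coprimeTo (suc k))

module _ {A : Set} (f : A → ℚ) (0≤f : ∀ x → 0ℚ ≤ f x) where

  0≤listSum : ∀ xs → 0ℚ ≤ foldr _+_ 0ℚ (map f xs)
  0≤listSum []       = ℚₚ.≤-refl
  0≤listSum (x ∷ xs) = 0≤+ (0≤f x) (0≤listSum xs)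

  term≤listSum : ∀ {x xs} → x ∈ₗ xs → f x ≤ foldr _+_ 0ℚ (map f xs)
  term≤listSum {xs = x ∷ xs} (here refl)  = q≡p+d⇒p≤q refl (0≤listSum xs)
  term≤listSum {xs = x ∷ xs} (there x∈xs) = ℚₚ.≤-trans (term≤listSum x∈xs)
    (q≡p+d⇒p≤q (ℚₚ.+-comm (f x) (foldr _+_ 0ℚ (map f xs))) (0≤f x))

∈⇒≤max : ∀ {A : Set} (f : A → ℕ) {x xs} → x ∈ₗ xs → f x ℕ.≤ foldr ℕ._⊔_ 0 (map f xs)
∈⇒≤max f {xs = y ∷ ys} (here refl)  = ℕₚ.m≤m⊔n (f y) (foldr ℕ._⊔_ 0 (map f ys))
∈⇒≤max f {xs = y ∷ ys} (there x∈ys) =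
  ℕₚ.≤-trans (∈⇒≤max f x∈ys) (ℕₚ.m≤n⊔m (f y) (foldr ℕ._⊔_ 0 (map f ys)))

module _ {n} (G : Hypergraph n) where

  adjacent? : ∀ i j → Dec (Adjacent G i j)
  adjacent? i j = ¬? (i Fin.≟ j) ×-dec map′ find (λ (_ , e∈ , ij∈e) → lose e∈ ij∈e)
    (anyₗ? (λ e → (i ∈? e) ×-dec (j ∈? e)) (edges G))

  adjacent-irrefl : ∀ {i} → ¬ Adjacent G i i
  adjacent-irrefl (i≢i , _) = i≢i refl

  adjacent-sym : ∀ {i j} → Adjacent G i j → Adjacent G j i
  adjacent-sym (i≢j , e , e∈ , i∈e , j∈e) = i≢j ∘ sym , e , e∈ , j∈e , i∈e

  open Greedy (Adjacent G) adjacent? adjacent-irrefl adjacent-sym public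

  adjacencyEntry-sym : Symmetric (adjacencyEntry G)
  adjacencyEntry-sym i j with i Fin.≟ j | j Fin.≟ i
  ... | yes _   | yes _   = refl
  ... | yes i≡j | no j≢i  = ⊥-elim (j≢i (sym i≡j))
  ... | no i≢j  | yes j≡i = ⊥-elim (i≢j (sym j≡i))
  ... | no _    | no _    = cong (λ es → foldr _+_ 0ℚ (map (λ e → 1/[ ∣ e ∣ -1]) es))
    (filter-≐ (λ e → (i ∈? e) ×-dec (j ∈? e)) (λ e → (j ∈? e) ×-dec (i ∈? e)) (swap , swap) (edges G))

  0≤adjacencyEntry : ∀ i j → 0ℚ ≤ adjacencyEntry G i j
  0≤adjacencyEntry i j with i Fin.≟ j
  ... | yes _ = ℚₚ.≤-refl
  ... | no _  = 0≤listSum (λ e → 1/[ ∣ e ∣ -1]) (λ e → 0≤1/[-1] ∣ e ∣)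
                  (filter (λ e → (i ∈? e) ×-dec (j ∈? e)) (edges G))

  -- A common edge `e` contributes 1/(|e| - 1), which is at least 1/(r - 1), and all other
  -- contributions are nonnegative.
  adjacent⇒1/[rank-1]≤entry : ∀ {i j} → Adjacent G i j → 1/[ rank G -1] ≤ adjacencyEntry G i j
  adjacent⇒1/[rank-1]≤entry {i} {j} (i≢j , e , e∈ , i∈e , j∈e) with i Fin.≟ j
  ... | yes i≡j = ⊥-elim (i≢j i≡j)
  ... | no _    = ℚₚ.≤-trans
    (1/[-1]-anti (All-lookup (edgeSize≥2 G) e∈) (∈⇒≤max ∣_∣ e∈))
    (term≤listSum (λ e → 1/[ ∣ e ∣ -1]) (λ e → 0≤1/[-1] ∣ e ∣)
      (∈-filter⁺ (λ e → (i ∈? e) ×-dec (j ∈? e)) e∈ (i∈e , j∈e)))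

  -- At the indicator `x` of `S`, each row of A x indexed by `S` is at least `ρ` times the degree,
  -- hence at least `t`. So every term of the form is nonpositive, although `x` is 1 at `v`; this
  -- contradicts definiteness.
  core⇒¬positivePivots : ∀ {k} → Core k →
    ¬ PositivePivots (shift (adjacencyEntry G) (1/[ rank G -1] * (ℤ.+ k / 1)))
  core⇒¬positivePivots {k} (S , (v , v∈S) , deg≥k) pp =
    1≢0 (v ∈? S) v∈S (positivePivots⇒definite (shift-sym adjacencyEntry-sym t) pp x quad≤0 v)
    where
    A = adjacencyEntry G
    ρ = 1/[ rank G -1]
    t = ρ * (ℤ.+ k / 1)

    x : Vector ℚ n
    x i = indicator (i ∈? S)

    1≢0 : ∀ {P : Set} (d : Dec P) → P → indicator d ≢ 0ℚ
    1≢0 (yes _) _ = ℚₚ.1≢0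
    1≢0 (no ¬p) p = ⊥-elim (¬p p)

    entry-bound : ∀ i j → ρ * indicator (neighbour? S i j) ≤ A i j * x j
    entry-bound i j = bound (j ∈? S) (adjacent? i j)
      where
      bound : (d : Dec (j ∈ S)) (d′ : Dec (Adjacent G i j)) →
        ρ * indicator (d ×-dec d′) ≤ A i j * indicator d
      bound (no _)  _        = ℚₚ.≤-reflexive (trans (ℚₚ.*-zeroʳ ρ) (sym (ℚₚ.*-zeroʳ (A i j))))
      bound (yes _) (no _)   = subst (_≤ A i j * 1ℚ) (sym (ℚₚ.*-zeroʳ ρ))
        (0≤* (0≤adjacencyEntry i j) (ℚₚ.nonNegative⁻¹ 1ℚ))
      bound (yes _) (yes ij) = ℚₚ.*-monoʳ-≤-nonNeg 1ℚ (adjacent⇒1/[rank-1]≤entry ij)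

    row-bound : ∀ i → i ∈ S → t ≤ mulVec A x i
    row-bound i i∈S = begin
      ρ * (ℤ.+ k / 1)
        ≤⟨ ℚₚ.*-monoˡ-≤-nonNeg ρ {{nonNegative (0≤1/[-1] (rank G))}} (fromℕ-mono (deg≥k i i∈S)) ⟩
      ρ * (ℤ.+ degree S i / 1)
        ≡⟨ cong (ρ *_) (count≡sum (neighbour? S i) (λ j → j)) ⟩
      ρ * sum (λ j → indicator (neighbour? S i j))
        ≡⟨ *-distribˡ-sum ρ (λ j → indicator (neighbour? S i j)) ⟩
      sum (λ j → ρ * indicator (neighbour? S i j))
        ≤⟨ sum-mono (entry-bound i) ⟩
      mulVec A x i ∎
      where open ℚₚ.≤-Reasoning

    term≤0 : ∀ i (d : Dec (i ∈ S)) → indicator d * (t * indicator d - mulVec A x i) ≤ 0ℚ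
    term≤0 i (no _)    = ℚₚ.≤-reflexive (ℚₚ.*-zeroˡ (t * 0ℚ - mulVec A x i))
    term≤0 i (yes i∈S) = begin
      1ℚ * (t * 1ℚ - mulVec A x i)
        ≡⟨ solve 2 (λ t m → con 1ℚ ⊗ (t ⊗ con 1ℚ ⊖ m) := t ⊖ m) refl t (mulVec A x i) ⟩
      t - mulVec A x i
        ≤⟨ ℚₚ.+-monoˡ-≤ (- mulVec A x i) (row-bound i i∈S) ⟩
      mulVec A x i - mulVec A x i
        ≡⟨ ℚₚ.+-inverseʳ (mulVec A x i) ⟩
      0ℚ ∎
      where open ℚₚ.≤-Reasoning

    quad≤0 : quad (shift A t) x ≤ 0ℚ
    quad≤0 = begin
      sum (λ i → x i * mulVec (shift A t) x i)
        ≡⟨ sum-cong-≗ (λ i → cong (x i *_) (mulVec-shift A t x i)) ⟩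
      sum (λ i → x i * (t * x i - mulVec A x i))
        ≤⟨ sum-mono (λ i → term≤0 i (i ∈? S)) ⟩
      sum {n} (λ _ → 0ℚ)
        ≡⟨ sum-replicate-zero n ⟩
      0ℚ ∎
      where open ℚₚ.≤-Reasoning

-- Hypergraphs without edges

edgeless-entry : ∀ {n} (G : Hypergraph n) → edges G ≡ [] → ∀ i j → adjacencyEntry G i j ≡ 0ℚ
edgeless-entry G no-edges i j with i Fin.≟ j
... | yes _ = refl
... | no _  = cong
  (λ es → foldr _+_ 0ℚ (map (λ e → 1/[ ∣ e ∣ -1]) (filter (λ e → (i ∈? e) ×-dec (j ∈? e)) es)))
  no-edges

-- The matrix is zero, so μ x vanishes; a positive `μ` could be cancelled, making the eigenvector
-- zero.
edgeless-eigenvalue≤0 : ∀ {n} (G : Hypergraph n) → edges G ≡ [] → ∀ μ → IsEigenvalue (adjacencyMatrix G) μ →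
  ∀ ε → 0ℚ < ε → Eventually (λ m → seq μ m < ε)
edgeless-eigenvalue≤0 G no-edges μ (x , x≢0 , Ax≃μx) = ¬positive⇒≤0 μ λ μ>0 →
  x≢0 λ i → Null⇒≃0 (x i) (positive*null⇒null μ (x i) μ>0 λ ε 0<ε →
    eventually-map (λ m → subst (_< ε) (eq i m)) (Ax≃μx i ε 0<ε))
  where
  A = adjacencyMatrix G

  Ax≡0 : ∀ i m → seq ((A ·ᵥ x) i) m ≡ 0ℚ
  Ax≡0 i m = trans (seq-sumℝ (λ j → A i j *ℝ x j) m)
    (trans (sum-cong-≗ (λ j → cong (_* seq (x j) m) (edgeless-entry G no-edges i j)))
      (sum-0* (λ j → seq (x j) m)))

  eq : ∀ i m → ℚ.∣ seq ((A ·ᵥ x) i) m - seq μ m * seq (x i) m ∣ ≡ ℚ.∣ seq μ m * seq (x i) m ∣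
  eq i m = trans (cong (λ q → ℚ.∣ q - μx ∣) (Ax≡0 i m))
    (trans (cong ℚ.∣_∣ (ℚₚ.+-identityˡ (- μx))) (ℚₚ.∣-p∣≡∣p∣ μx))
    where μx = seq μ m * seq (x i) m

-- With rank 0 the factor of `μ` is -1, so the claim reads γ ≤ 1 - μ. It follows from the constant
-- colouring and from `μ` being at most 0.
edgeless-bound : ∀ {n} (G : Hypergraph n) → edges G ≡ [] →
  (γ : ℕ) → IsStrongChromaticNumber G γ → ∀ μ → IsEigenvalue (adjacencyMatrix G) μ →
  fromℕ γ ≤ℝ 1ℝ +ℝ (fromℕ 0 -ℝ 1ℝ) *ℝ μ
edgeless-bound G no-edges γ (_ , γ-least) μ eig ε 0<ε = eventually-map
  (λ m μ<ε → begin-strict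
    ℤ.+ γ / 1                                ≤⟨ fromℕ-mono (γ-least 1 ((λ _ → zero) , not-adjacent)) ⟩
    1ℚ                                       <⟨ q≡p+d⇒p<q refl (p<q⇒0<q-p μ<ε) ⟩
    1ℚ + (ε - seq μ m)
      ≡⟨ solve 2 (λ e l → con 1ℚ ⊕ (e ⊖ l) := con 1ℚ ⊕ (con 0ℚ ⊖ con 1ℚ) ⊗ l ⊕ e) refl ε (seq μ m) ⟩
    1ℚ + (0ℚ - 1ℚ) * seq μ m + ε ∎)
  (edgeless-eigenvalue≤0 G no-edges μ eig ε 0<ε)
  where
  open ℚₚ.≤-Reasoning
  not-adjacent : IsStrongColoring G 1 (λ _ → zero)
  not-adjacent _ _ (_ , e , e∈ , _) with () ← subst (e ∈ₗ_) no-edges e∈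

-- Hypergraphs with an edge, and the final bound

module _ {n} (G : Hypergraph n) (s : ℕ) (rank≡ : rank G ≡ suc (suc s))
  (k : ℕ) (core : Core G k) (μ : ℝ) (μ-max : IsLargestEigenvalue (adjacencyMatrix G) μ) where

  private
    ρ = 1/[ rank G -1]
    t = ρ * (ℤ.+ k / 1)
    R = ℤ.+ suc (suc s) / 1 - 1ℚ

    R≡fromℕ : R ≡ ℤ.+ suc s / 1
    R≡fromℕ = trans (cong (_- 1ℚ) (fromℕ-suc (suc s)))
      (solve 1 (λ q → con 1ℚ ⊕ q ⊖ con 1ℚ := q) refl (ℤ.+ suc s / 1))

    0<R : 0ℚ < R
    0<R = subst (0ℚ <_) (sym R≡fromℕ) (ℚₚ.positive⁻¹ (ℤ.+ suc s / 1) {{ℚₚ.normalize-pos (suc s) 1}})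

    Rρ≡1 : R * ρ ≡ 1ℚ
    Rρ≡1 = trans (cong₂ _*_ R≡fromℕ (cong 1/[_-1] rank≡)) (fromℕ*1/suc s)

    0<ρ : 0ℚ < ρ
    0<ρ = subst (λ r → 0ℚ < 1/[ r -1]) (sym rank≡)
      (ℚₚ.positive⁻¹ (ℤ.+ 1 / suc s) {{ℚₚ.normalize-pos 1 (suc s)}})

    cancel : ∀ q → R * (ρ * q) ≡ q
    cancel q = trans (sym (ℚₚ.*-assoc R ρ q)) (trans (cong (_* q) Rρ≡1) (ℚₚ.*-identityˡ q))

  core-bound : fromℕ (suc k) ≤ℝ 1ℝ +ℝ (fromℕ (suc (suc s)) -ℝ 1ℝ) *ℝ μ
  core-bound ε 0<ε =
    let ν , t≤ν , ¬¬eig = eigenvalue-above (adjacencyEntry G) (adjacencyEntry-sym G) (0≤adjacencyEntry G) t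
          (0≤* (ℚₚ.<⇒≤ 0<ρ) (0≤fromℕ k)) (core⇒¬positivePivots G core)
        -- Maximality of `μ` applies to genuine eigenvalues only, so it is invoked under the double
        -- negation.
        ν≤μ = ≤ℝ-stable ν μ λ ν≰μ → ¬¬eig λ eig → ν≰μ (proj₂ μ-max ν eig)
    in eventually-map (λ m ν<μ+ρε → bound (seq μ m) (ℚₚ.≤-<-trans (t≤ν m) ν<μ+ρε))
         -- The tolerance `ρ * ε` becomes `ε` after multiplication by `R`, which is r - 1.
         (ν≤μ (ρ * ε) (0<* 0<ρ 0<ε))
    where
    open ℚₚ.≤-Reasoning
    bound : ∀ l → t < l + ρ * ε → ℤ.+ suc k / 1 < 1ℚ + R * l + ε
    bound l t<l+ρε = begin-strict
      ℤ.+ suc k / 1                ≡⟨ fromℕ-suc k ⟩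
      1ℚ + ℤ.+ k / 1               ≡⟨ cong (1ℚ +_) (cancel (ℤ.+ k / 1)) ⟨
      1ℚ + R * t                   <⟨ ℚₚ.+-monoʳ-< 1ℚ (ℚₚ.*-monoʳ-<-pos R {{positive 0<R}} t<l+ρε) ⟩
      1ℚ + R * (l + ρ * ε)         ≡⟨ cong (1ℚ +_) (ℚₚ.*-distribˡ-+ R l (ρ * ε)) ⟩
      1ℚ + (R * l + R * (ρ * ε))   ≡⟨ cong (λ q → 1ℚ + (R * l + q)) (cancel ε) ⟩
      1ℚ + (R * l + ε)             ≡⟨ ℚₚ.+-assoc 1ℚ (R * l) ε ⟨
      1ℚ + R * l + ε ∎

edge⇒2≤rank : ∀ {n} (G : Hypergraph n) {e} → e ∈ₗ edges G → 2 ℕ.≤ rank G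
edge⇒2≤rank G e∈ = ℕₚ.≤-trans (All-lookup (edgeSize≥2 G) e∈) (∈⇒≤max ∣_∣ e∈)

-- Otherwise `k` colours would suffice, one fewer than the minimum.
chromatic⇒core : ∀ {n} (G : Hypergraph n) → Fin n → ∀ k → IsStrongChromaticNumber G (suc k) → Core G k
chromatic⇒core G v k (_ , least) with core-or-colorable G v k
... | inj₁ core         = core
... | inj₂ (c , proper) = ⊥-elim (ℕₚ.1+n≰n (least k (c , λ i j → proper i j ∈⊤ ∈⊤)))

theorem3 : (n : ℕ) (G : Hypergraph n) (r : ℕ) → rank G ≡ r →
    (γ : ℕ) → IsStrongChromaticNumber G γ →
    (λmax : ℝ) → IsLargestEigenvalue (adjacencyMatrix G) λmax →
    fromℕ γ ≤ℝ 1ℝ +ℝ (fromℕ r -ℝ 1ℝ) *ℝ λmax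
-- In dimension 0 every vector is zero, so there is no eigenvalue.
theorem3 zero G r rank≡r γ χ λmax ((_ , x≢0 , _) , _) = ⊥-elim (x≢0 λ ())
theorem3 (suc n) G r rank≡r zero ((c , _) , _) λmax λ-max = ⊥-elim (Finₚ.¬Fin0 (c zero))
-- An edge forces the rank to be at least 2, so r - 1 is invertible; the edgeless case has rank 0
-- and is separate.
theorem3 (suc n) G r rank≡r (suc k) χ λmax λ-max = cases (edges G) refl r rank≡r
  where
  cases : ∀ es → edges G ≡ es → ∀ r → rank G ≡ r → fromℕ (suc k) ≤ℝ 1ℝ +ℝ (fromℕ r -ℝ 1ℝ) *ℝ λmax
  cases [] edges≡ r rank≡ = subst (λ r → fromℕ (suc k) ≤ℝ 1ℝ +ℝ (fromℕ r -ℝ 1ℝ) *ℝ λmax)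
    (trans (cong (λ es → foldr ℕ._⊔_ 0 (map ∣_∣ es)) (sym edges≡)) rank≡)
    (edgeless-bound G edges≡ (suc k) χ λmax (proj₁ λ-max))
  cases (e ∷ es) edges≡ r rank≡ = large r rank≡
    (subst (2 ℕ.≤_) rank≡ (edge⇒2≤rank G (subst (e ∈ₗ_) (sym edges≡) (here refl))))
    where
    large : ∀ r → rank G ≡ r → 2 ℕ.≤ r → fromℕ (suc k) ≤ℝ 1ℝ +ℝ (fromℕ r -ℝ 1ℝ) *ℝ λmax
    large (suc (suc s)) rank≡ _ = core-bound G s rank≡ k (chromatic⇒core G zero k χ) λmax λ-max
    large (suc zero) _ (ℕ.s≤s ())
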